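{- Let $h=(h(n))_{n\ge1}$ be a sequence of positive real numbers with $h(1)=1$. For every $n\ge 2$, \[ P_n^h(-z)=\frac{(-1)^n\,z}{\prod_{k=1}^n h(k)}\,\det\!\left(zI_{n-1}-M_n^h\right), \] where $I_{n-1}$ is the identity matrix of size $n-1$. Moreover, the matrix $M_n^h$ has nonnegative entries.
   Context: Let $\sigma(k)=\sum_{d\mid k}d$. The generalized D'Arcais polynomials are defined by $P_0^h(z)=1$ and $P_n^h(z)=\frac{z}{h(n)}\sum_{k=1}^n\sigma(k)P_{n-k}^h(z)$ for $n\ge1$. The sequence $(c_n)_{n\ge0}$ is defined by $c_0:=1$ and \[ c_n:=\sum_{k=0}^{n-1}(-1)^{n-k+1}\sigma(n-k+1)\,c_k,\qquad n\ge1. \] For $n\ge2$, $M_n^h$ is the $(n-1)\times(n-1)$ matrix with entries, for $1\le i,j\le n-1$, \[ (M_n^h)_{ij}=\begin{cases} c_{i-j+1}\,h(j), & i\ge j-1,\\ 0, & j>i+1.\end{cases} \] -}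

module Defs where

open import Algebra.Apartness.Structures using (IsHeytingField)
open import Algebra.Bundles using (CommutativeRing; Semiring)
import Algebra.Definitions.RawSemiring
open import Algebra.Morphism.Structures using (IsRingHomomorphism)
import Algebra.Properties.Ring
open import Data.Bool.Base using (if_then_else_)
open import Data.Fin.Base using (Fin; zero; suc; toℕ; punchIn)
open import Data.Fin.Properties using (_≟_)
open import Data.Integer.Base as ℤ using (ℤ; +_; -[1+_]; 1ℤ; -1ℤ)
open import Data.List.Base using (filter; upTo)
open import Data.Nat.Base as ℕ using (ℕ; zero; suc; _∸_)
open import Data.Nat.Divisibility using (_∣?_)
open import Data.Nat.ListAction using () renaming (sum to listSum)
open import Data.Nat.Properties using (_≤?_)
open import Data.Product.Base using (_,_; proj₁; proj₂)
open import Data.Sum.Base using (_⊎_; inj₁; inj₂)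
open import Data.Vec.Base using (Vec; []; _∷_; head; lookup)
open import Level using (Level; _⊔_) renaming (suc to lsuc)
open import Relation.Binary.Core using (Rel)
open import Relation.Binary.PropositionalEquality using (_≡_; refl)
open import Relation.Binary.Structures using (IsStrictPartialOrder)
open import Relation.Nullary using (¬_; does)

-- The strict order is primitive and apartness is "less or greater", so that
-- elements apart from 0 are invertible.  Classically these are exactly the
-- (linearly) ordered fields; constructively the real numbers are an instance
-- as well.
record OrderedField (c ℓ₁ ℓ₂ : Level) : Set (lsuc (c ⊔ ℓ₁ ⊔ ℓ₂)) where
  infix  8 -_
  infixl 7 _*_
  infixl 6 _+_
  infix  4 _≈_ _<_ _≤_
  field
    Carrier : Set c
    _≈_     : Rel Carrier ℓ₁
    _<_     : Rel Carrier ℓ₂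
    _+_     : Carrier → Carrier → Carrier
    _*_     : Carrier → Carrier → Carrier
    -_      : Carrier → Carrier
    0#      : Carrier
    1#      : Carrier
    isHeytingField       : IsHeytingField _≈_ (λ x y → x < y ⊎ y < x)
                                          _+_ _*_ -_ 0# 1#
    isStrictPartialOrder : IsStrictPartialOrder _≈_ _<_
    +-monoˡ-<            : ∀ z {x y} → x < y → x + z < y + z
    *-positive           : ∀ {x y} → 0# < x → 0# < y → 0# < x * y

  _≤_ : Rel Carrier ℓ₂
  x ≤ y = ¬ (y < x)

  module HF = IsHeytingField isHeytingField
  module <  = IsStrictPartialOrder isStrictPartialOrder

  commutativeRing : CommutativeRing c ℓ₁
  commutativeRing = record { isCommutativeRing = HF.isCommutativeRing }

  open CommutativeRing commutativeRing public
    using (ring; semiring; rawRing; _-_)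

  open Algebra.Definitions.RawSemiring (Semiring.rawSemiring semiring) public
    using (_×_; product)

  private
    module R = Algebra.Properties.Ring ring

    x-0≈x : ∀ x → x - 0# ≈ x
    x-0≈x x = HF.trans (HF.+-congˡ R.-0#≈0#) (HF.+-identityʳ x)

    -1*-1≈1 : - 1# * - 1# ≈ 1#
    -1*-1≈1 = HF.trans (R.-1*x≈-x (- 1#)) (R.-‿involutive 1#)

  0<1 : 0# < 1#
  0<1 with HF.invertible⇒# {1#} {0#} 1-0-invertible
    where
    inverse : 1# * (1# - 0#) ≈ 1#
    inverse = HF.trans (HF.*-identityˡ _) (x-0≈x 1#)
    1-0-invertible = 1# , inverse , HF.trans (HF.*-comm _ _) inverse
  ... | inj₂ 0<1 = 0<1
  ... | inj₁ 1<0 = <.<-respʳ-≈ -1*-1≈1 (*-positive 0<-1 0<-1)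
    where
    0<-1 : 0# < - 1#
    0<-1 = <.<-respˡ-≈ (HF.-‿inverseʳ 1#)
             (<.<-respʳ-≈ (HF.+-identityˡ (- 1#)) (+-monoˡ-< (- 1#) 1<0))

  recip : ∀ {x} → 0# < x → Carrier
  recip 0<x = proj₁ (HF.#⇒invertible (inj₂ 0<x))

  recip-inverseˡ : ∀ {x} (0<x : 0# < x) → recip 0<x * x ≈ 1#
  recip-inverseˡ {x} 0<x =
    HF.trans (HF.*-congˡ (HF.sym (x-0≈x x)))
             (proj₁ (proj₂ (HF.#⇒invertible (inj₂ 0<x))))

  product-positive : ∀ {n} (f : Fin n → Carrier) →
                     (∀ i → 0# < f i) → 0# < product f
  product-positive {zero}  f f>0 = 0<1
  product-positive {suc n} f f>0 =
    *-positive (f>0 zero) (product-positive (λ i → f (suc i)) (λ i → f>0 (suc i)))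

  fromℤ : ℤ → Carrier
  fromℤ (+ n)    = n × 1#
  fromℤ -[1+ n ] = - (suc n × 1#)

-- Taking K itself, its complexification or K[X] gives z real, z complex or
-- z an indeterminate.
record CommutativeAlgebra {c ℓ₁ ℓ₂} (K : OrderedField c ℓ₁ ℓ₂) (a ℓ : Level)
       : Set (c ⊔ ℓ₁ ⊔ lsuc (a ⊔ ℓ)) where
  field
    commutativeRing : CommutativeRing a ℓ
  open CommutativeRing commutativeRing public
  field
    ι                  : OrderedField.Carrier K → Carrier
    isRingHomomorphism : IsRingHomomorphism (OrderedField.rawRing K) rawRing ι
  open Algebra.Definitions.RawSemiring (Semiring.rawSemiring semiring) public
    using (_×_; _^_; sum)

module Matrices {a ℓ} (R : CommutativeRing a ℓ) where
  open CommutativeRing R hiding (zero)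
  open Algebra.Definitions.RawSemiring (Semiring.rawSemiring semiring)
    using (_^_; sum)

  Matrix : ℕ → Set a
  Matrix n = Fin n → Fin n → Carrier

  identity : ∀ n → Matrix n
  identity n i j = if does (i ≟ j) then 1# else 0#

  -- Laplace expansion along the first row.
  det : ∀ {n} → Matrix n → Carrier
  det {zero}  A = 1#
  det {suc n} A =
    sum (λ j → (- 1#) ^ toℕ j * A zero j * det (λ r s → A (suc r) (punchIn j s)))

σ : ℕ → ℕ
σ k = listSum (filter (_∣? k) (upTo (suc k)))

-- history x₀ step n = xₙ ∷ … ∷ x₀, where step n computes xₙ₊₁ from that list.
history : ∀ {a} {A : Set a} → A → (∀ n → Vec A (suc n) → A) →
          ∀ n → Vec A (suc n)
history x₀ step zero    = x₀ ∷ []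
history x₀ step (suc n) = step n (history x₀ step n) ∷ history x₀ step n

recursiveSequence : ∀ {a} {A : Set a} → A → (∀ n → Vec A (suc n) → A) → ℕ → A
recursiveSequence x₀ step n = head (history x₀ step n)

lookup-history : ∀ {a} {A : Set a} (x₀ : A) (step : ∀ n → Vec A (suc n) → A)
                 n (i : Fin (suc n)) →
                 lookup (history x₀ step n) i ≡
                 recursiveSequence x₀ step (n ∸ toℕ i)
lookup-history x₀ step zero    zero    = refl
lookup-history x₀ step (suc n) zero    = refl
lookup-history x₀ step (suc n) (suc i) = lookup-history x₀ step n i

-- The defining sum for cₙ₊₁, reindexed by k = n - i, so that the exponent and
-- the argument of σ are (n + 1) - k + 1 = i + 2.
c : ℕ → ℤ
c = recursiveSequence 1ℤ λ n cₙ⋯c₀ →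
      sum (λ (i : Fin (suc n)) →
        -1ℤ ℤ.^ (2 ℕ.+ toℕ i) ℤ.* + σ (2 ℕ.+ toℕ i) ℤ.* lookup cₙ⋯c₀ i)
  where open Algebra.Definitions.RawSemiring ℤ.+-*-rawSemiring using (sum)

-- The values h n for n ≥ 1 are the only ones used; h 0 is junk.
module DArcais {k ℓ₁ ℓ₂} (K : OrderedField k ℓ₁ ℓ₂)
               (h : ℕ → OrderedField.Carrier K) where
  open OrderedField K

  Positive : Set ℓ₂
  Positive = ∀ n → 0# < h (suc n)

  ∏h : ℕ → Carrier
  ∏h n = product (λ (i : Fin n) → h (suc (toℕ i)))

  ∏h-positive : Positive → ∀ n → 0# < ∏h n
  ∏h-positive h>0 n = product-positive {n} _ (λ i → h>0 (toℕ i))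

  entry : ℕ → ℕ → Carrier
  entry i j = if does (j ≤? suc i) then fromℤ (c (suc i ∸ j)) * h j else 0#

  M : ∀ n → Matrices.Matrix commutativeRing (n ∸ 1)
  M n i j = entry (suc (toℕ i)) (suc (toℕ j))

  module _ {a ℓ} (A : CommutativeAlgebra K a ℓ) (h>0 : Positive) where
    private module A = CommutativeAlgebra A

    -- The sum for Pₙ₊₁ has i = k - 1, so that Pₙ₊₁₋ₖ = Pₙ₋ᵢ.
    P : ℕ → A.Carrier → A.Carrier
    P n z = recursiveSequence A.1# (λ m Pₘ⋯P₀ →
              z A.* A.ι (recip (h>0 m)) A.*
              A.sum (λ (i : Fin (suc m)) → σ (suc (toℕ i)) A.× lookup Pₘ⋯P₀ i)) n

  module _ {a ℓ} (A : CommutativeAlgebra K a ℓ) where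
    private module A = CommutativeAlgebra A
    open Matrices A.commutativeRing

    zI-M : ∀ n → A.Carrier → Matrix (n ∸ 1)
    zI-M n z i j = z A.* identity (n ∸ 1) i j A.- A.ι (M n i j)

{-# OPTIONS --safe #-}

-- Write s n = (-1)ⁿ σ(n + 1), so that c * s = 1 for the Cauchy product *.
--
-- Determinant.  Put rₙ = (-1)ⁿ Pₙ(-z); then rₙ₊₁ = z Yₙ with h(n + 1) Yₙ = (s * r)ₙ
-- =: gₙ, and c * g = r.  In zI - M the first row vanishes beyond its second entry,
-- so a Laplace expansion merges the first two columns into one and lowers the size
-- by one.  After t steps the head of the first column is h(1) ⋯ h(t + 1) gₜ₊₁,
-- because the recursion it satisfies is c * g = r; at size one this is the
-- determinant.
--
-- Nonnegativity.  Multiplying ∑ s n xⁿ by (1 + x)² (1 - x) turns c * s = 1 into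
--   cₙ = 2 cₙ₋₁ + cₙ₋₃ + 2 cₙ₋₄ + 3 cₙ₋₅ + 3 cₙ₋₆ + cₙ₋₇ - 2 cₙ₋₈ - 2 cₙ₋₉ + ⋯ ,
-- whose later coefficients grow at most quadratically.  By induction cₙ₊₁ ≥ 2 cₙ for
-- n ≥ 4: the earlier growth makes the tail smaller than the leading positive terms.

module Submission where

open import Algebra.Bundles using (CommutativeRing; Semiring)
import Algebra.Definitions.RawSemiring
import Algebra.Morphism.Construct.Composition as Composition
open import Algebra.Morphism.Structures using (IsRingHomomorphism)
import Algebra.Properties.CommutativeMonoid.Sum
import Algebra.Properties.Monoid.Sum
import Algebra.Properties.Ring
import Algebra.Properties.Semiring.Mult
import Algebra.Properties.Semiring.Sum
import Algebra.Solver.Ring.NaturalCoefficients.Default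
open import Data.Bool.Base using (T; true; false; if_then_else_)
open import Data.Fin.Base using (Fin; zero; suc; toℕ; fromℕ<; punchIn)
open import Data.Fin using (#_)
open import Data.Fin.Properties using (_≟_; all?; toℕ-fromℕ<)
open import Data.Integer.Base as ℤ
  using (ℤ; +_; -[1+_]; _⊖_; ∣_∣; 0ℤ; 1ℤ; -1ℤ; +≤+; -≤+)
import Data.Integer.Properties as ℤ
open import Data.Integer.Tactic.RingSolver using (solve-∀)
open import Data.List.Base using ([]; _∷_; filter; applyUpTo; upTo)
open import Data.Nat.Base as ℕ using (ℕ; zero; suc; _∸_; _≡ᵇ_; _<ᵇ_; z≤n; s≤s)
open import Data.Nat.Divisibility using (_∣?_)
open import Data.Nat.ListAction using () renaming (sum to listSum)
import Data.Nat.Properties as ℕ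
import Data.Nat.Tactic.RingSolver as ℕSolver
open import Data.Sum.Base using (inj₁; inj₂)
open import Data.Vec.Base using (Vec; []; _∷_; lookup)
open import Function.Base using (_∘_)
open import Relation.Binary.PropositionalEquality as ≡ using (_≡_; module ≡-Reasoning)
import Relation.Binary.Reasoning.Setoid
open import Relation.Nullary using (does; yes; no)
open import Relation.Nullary.Decidable using (toWitness)
open import Relation.Unary using (Pred; Decidable)
open import Defs

-- Cauchy products of sequences over a commutative ring.

module Convolution {a ℓ} (R : CommutativeRing a ℓ) where
  open CommutativeRing R hiding (zero)
  open Algebra.Definitions.RawSemiring (Semiring.rawSemiring semiring)
    using (_^_; sum)
  open Algebra.Properties.Semiring.Sum semiring using (*-distribˡ-sum)
  open Algebra.Properties.CommutativeMonoid.Sum +-commutativeMonoid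
    using (sum-cong-≋; ∑-distrib-+)
  open Algebra.Solver.Ring.NaturalCoefficients.Default commutativeSemiring
  open Relation.Binary.Reasoning.Setoid setoid

  Sequence : Set a
  Sequence = ℕ → Carrier

  opaque
    conv : Sequence → Sequence → Sequence
    conv f g n = sum (λ (i : Fin (suc n)) → f (toℕ i) * g (n ∸ toℕ i))

    conv≈sum : ∀ f g n → conv f g n ≈ sum (λ (i : Fin (suc n)) → f (toℕ i) * g (n ∸ toℕ i))
    conv≈sum f g n = refl

    conv-zero : ∀ f g → conv f g 0 ≈ f 0 * g 0 + 0#
    conv-zero f g = refl

    -- Splitting off the first term shifts `f` and leaves `g` alone, so the inductions below
    -- generalise over `f`.
    conv-suc : ∀ f g n → conv f g (suc n) ≈ f 0 * g (suc n) + conv (f ∘ suc) g n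
    conv-suc f g n = refl

    conv-congˡ : ∀ {f f′} → (∀ n → f n ≈ f′ n) → ∀ g n → conv f g n ≈ conv f′ g n
    conv-congˡ f≈ g n = sum-cong-≋ {suc n} (λ i → *-congʳ {g (n ∸ toℕ i)} (f≈ (toℕ i)))

    conv-*ˡ : ∀ x f g n → conv (λ k → x * f k) g n ≈ x * conv f g n
    conv-*ˡ x f g n = begin
      conv (λ k → x * f k) g n
        ≈⟨ sum-cong-≋ {suc n} (λ i → *-assoc x (f (toℕ i)) (g (n ∸ toℕ i))) ⟩
      sum (λ (i : Fin (suc n)) → x * (f (toℕ i) * g (n ∸ toℕ i)))
        ≈⟨ *-distribˡ-sum x (λ (i : Fin (suc n)) → f (toℕ i) * g (n ∸ toℕ i)) ⟨
      x * conv f g n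
        ∎

    conv-+ˡ : ∀ f f′ g n → conv (λ k → f k + f′ k) g n ≈ conv f g n + conv f′ g n
    conv-+ˡ f f′ g n = begin
      conv (λ k → f k + f′ k) g n
        ≈⟨ sum-cong-≋ {suc n} (λ i → distribʳ (g (n ∸ toℕ i)) (f (toℕ i)) (f′ (toℕ i))) ⟩
      sum (λ (i : Fin (suc n)) → f (toℕ i) * g (n ∸ toℕ i) + f′ (toℕ i) * g (n ∸ toℕ i))
        ≈⟨ ∑-distrib-+ {suc n} (λ i → f (toℕ i) * g (n ∸ toℕ i))
                               (λ i → f′ (toℕ i) * g (n ∸ toℕ i)) ⟩
      conv f g n + conv f′ g n
        ∎

    conv-zeroˡ : ∀ {f} → (∀ n → f n ≈ 0#) → ∀ g n → conv f g n ≈ 0#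
    conv-zeroˡ {f} f≈0 g n = begin
      conv f g n                 ≈⟨ conv-congˡ (λ k → trans (f≈0 k) (sym (zeroˡ 0#))) g n ⟩
      conv (λ _ → 0# * 0#) g n   ≈⟨ conv-*ˡ 0# (λ _ → 0#) g n ⟩
      0# * conv (λ _ → 0#) g n   ≈⟨ zeroˡ _ ⟩
      0#                         ∎

    -- The shift of `conv f g` is `f 0` times the shift of `g`, plus `conv (f ∘ suc) g`; linearity
    -- in the first argument then reduces the step to the induction hypothesis for `f ∘ suc`.
    conv-assoc : ∀ f g h n → conv (conv f g) h n ≈ conv f (conv g h) n
    conv-assoc f g h zero =
      solve 3 (λ x y z → (x :* y :+ con 0) :* z :+ con 0 := x :* (y :* z :+ con 0) :+ con 0)
        refl (f 0) (g 0) (h 0)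
    conv-assoc f g h (suc n) = begin
      (f 0 * g 0 + 0#) * h (suc n) + conv (λ k → f 0 * g (suc k) + conv (f ∘ suc) g k) h n
        ≈⟨ +-congˡ (conv-+ˡ (λ k → f 0 * g (suc k)) (conv (f ∘ suc) g) h n) ⟩
      (f 0 * g 0 + 0#) * h (suc n) +
      (conv (λ k → f 0 * g (suc k)) h n + conv (conv (f ∘ suc) g) h n)
        ≈⟨ +-congˡ (+-cong (conv-*ˡ (f 0) (g ∘ suc) h n) (conv-assoc (f ∘ suc) g h n)) ⟩
      (f 0 * g 0 + 0#) * h (suc n) + (f 0 * conv (g ∘ suc) h n + conv (f ∘ suc) (conv g h) n)
        ≈⟨ solve 5 (λ x y z u v → (x :* y :+ con 0) :* z :+ (x :* u :+ v)
                               := x :* (y :* z :+ u) :+ v)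
             refl (f 0) (g 0) (h (suc n)) (conv (g ∘ suc) h n) (conv (f ∘ suc) (conv g h) n) ⟩
      f 0 * (g 0 * h (suc n) + conv (g ∘ suc) h n) + conv (f ∘ suc) (conv g h) n
        ∎

    -- Peeling `f 0` on one side and `g 0` on the other leaves a product of two shifted sequences,
    -- symmetric by the hypothesis two steps lower; hence two base cases.
    conv-comm : ∀ f g n → conv f g n ≈ conv g f n
    conv-comm f g zero = +-congʳ (*-comm (f 0) (g 0))
    conv-comm f g (suc zero) =
      solve 4 (λ x y z w → x :* y :+ (z :* w :+ con 0) := w :* z :+ (y :* x :+ con 0))
        refl (f 0) (g 1) (f 1) (g 0)
    conv-comm f g (suc (suc n)) = begin
      f 0 * g (2 ℕ.+ n) + conv (f ∘ suc) g (suc n)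
        ≈⟨ +-congˡ (conv-comm (f ∘ suc) g (suc n)) ⟩
      f 0 * g (2 ℕ.+ n) + (g 0 * f (2 ℕ.+ n) + conv (g ∘ suc) (f ∘ suc) n)
        ≈⟨ +-congˡ (+-congˡ (conv-comm (g ∘ suc) (f ∘ suc) n)) ⟩
      f 0 * g (2 ℕ.+ n) + (g 0 * f (2 ℕ.+ n) + conv (f ∘ suc) (g ∘ suc) n)
        ≈⟨ solve 5 (λ x y z w u → x :* y :+ (z :* w :+ u) := z :* w :+ (x :* y :+ u))
             refl (f 0) (g (2 ℕ.+ n)) (g 0) (f (2 ℕ.+ n)) (conv (f ∘ suc) (g ∘ suc) n) ⟩
      g 0 * f (2 ℕ.+ n) + (f 0 * g (2 ℕ.+ n) + conv (f ∘ suc) (g ∘ suc) n)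
        ≈⟨ +-congˡ (conv-comm f (g ∘ suc) (suc n)) ⟩
      g 0 * f (2 ℕ.+ n) + conv (g ∘ suc) f (suc n)
        ∎

    -- Substituting `x` times the variable into a power series is multiplicative. With `x = - 1#` it
    -- distributes the signs over the factors.
    ^-conv : ∀ x f g n →
             x ^ n * conv f g n ≈ conv (λ k → x ^ k * f k) (λ k → x ^ k * g k) n
    ^-conv x f g zero =
      solve 2 (λ u v → con 1 :* (u :* v :+ con 0) := con 1 :* u :* (con 1 :* v) :+ con 0)
        refl (f 0) (g 0)
    ^-conv x f g (suc n) = begin
      x * x ^ n * (f 0 * g (suc n) + conv (f ∘ suc) g n)
        ≈⟨ solve 5 (λ x y u v w → x :* y :* (u :* v :+ w)
                               := con 1 :* u :* (x :* y :* v) :+ x :* (y :* w))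
             refl x (x ^ n) (f 0) (g (suc n)) (conv (f ∘ suc) g n) ⟩
      1# * f 0 * (x * x ^ n * g (suc n)) + x * (x ^ n * conv (f ∘ suc) g n)
        ≈⟨ +-congˡ (*-congˡ (^-conv x (f ∘ suc) g n)) ⟩
      1# * f 0 * (x * x ^ n * g (suc n)) + x * conv (λ k → x ^ k * f (suc k)) g′ n
        ≈⟨ +-congˡ (conv-*ˡ x (λ k → x ^ k * f (suc k)) g′ n) ⟨
      1# * f 0 * (x * x ^ n * g (suc n)) + conv (λ k → x * (x ^ k * f (suc k))) g′ n
        ≈⟨ +-congˡ (conv-congˡ (λ k → *-assoc x (x ^ k) (f (suc k))) g′ n) ⟨
      1# * f 0 * (x * x ^ n * g (suc n)) + conv (λ k → x * x ^ k * f (suc k)) g′ n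
        ∎
      where
      g′ : Sequence
      g′ k = x ^ k * g k

  -- The generating series of `f` and `g` have product 1.
  Inverse : Sequence → Sequence → Set ℓ
  Inverse f g = ∀ n → conv f g n ≈ (if n ≡ᵇ 0 then 1# else 0#)

  conv-cancel : ∀ {f g} → Inverse f g → ∀ r n → conv f (conv g r) n ≈ r n
  conv-cancel {f} {g} f*g≈1 r n = trans (sym (conv-assoc f g r n)) (identity n)
    where
    identity : ∀ n → conv (conv f g) r n ≈ r n
    identity zero    = begin
      conv (conv f g) r 0    ≈⟨ conv-zero (conv f g) r ⟩
      conv f g 0 * r 0 + 0#  ≈⟨ +-identityʳ _ ⟩
      conv f g 0 * r 0       ≈⟨ *-congʳ (f*g≈1 0) ⟩
      1# * r 0               ≈⟨ *-identityˡ (r 0) ⟩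
      r 0                    ∎
    identity (suc n) = begin
      conv (conv f g) r (suc n)
        ≈⟨ conv-suc (conv f g) r n ⟩
      conv f g 0 * r (suc n) + conv (conv f g ∘ suc) r n
        ≈⟨ +-cong (*-congʳ (f*g≈1 0)) (conv-zeroˡ (f*g≈1 ∘ suc) r n) ⟩
      1# * r (suc n) + 0#
        ≈⟨ solve 1 (λ x → con 1 :* x :+ con 0 := x) refl (r (suc n)) ⟩
      r (suc n)
        ∎

-- Cauchy products under ring homomorphisms.

module _ {a ℓ b ℓ′} (R : CommutativeRing a ℓ) (S : CommutativeRing b ℓ′) where
  private
    module R = CommutativeRing R
    module S = CommutativeRing S
    module CR = Convolution R
    module CS = Convolution S
  open Relation.Binary.Reasoning.Setoid S.setoid

  conv-map : ∀ {φ} → IsRingHomomorphism R.rawRing S.rawRing φ →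
             ∀ f g n → φ (CR.conv f g n) S.≈ CS.conv (φ ∘ f) (φ ∘ g) n
  conv-map {φ} φ-hom = map
    where
    open IsRingHomomorphism φ-hom
    map : ∀ f g n → φ (CR.conv f g n) S.≈ CS.conv (φ ∘ f) (φ ∘ g) n
    map f g zero = begin
      φ (CR.conv f g 0)                  ≈⟨ ⟦⟧-cong (CR.conv-zero f g) ⟩
      φ (f 0 R.* g 0 R.+ R.0#)           ≈⟨ +-homo _ _ ⟩
      φ (f 0 R.* g 0) S.+ φ R.0#         ≈⟨ S.+-cong (*-homo _ _) 0#-homo ⟩
      φ (f 0) S.* φ (g 0) S.+ S.0#       ≈⟨ CS.conv-zero (φ ∘ f) (φ ∘ g) ⟨
      CS.conv (φ ∘ f) (φ ∘ g) 0          ∎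
    map f g (suc n) = begin
      φ (CR.conv f g (suc n))
        ≈⟨ ⟦⟧-cong (CR.conv-suc f g n) ⟩
      φ (f 0 R.* g (suc n) R.+ CR.conv (f ∘ suc) g n)
        ≈⟨ +-homo _ _ ⟩
      φ (f 0 R.* g (suc n)) S.+ φ (CR.conv (f ∘ suc) g n)
        ≈⟨ S.+-cong (*-homo _ _) (map (f ∘ suc) g n) ⟩
      φ (f 0) S.* φ (g (suc n)) S.+ CS.conv (φ ∘ f ∘ suc) (φ ∘ g) n
        ≈⟨ CS.conv-suc (φ ∘ f) (φ ∘ g) n ⟨
      CS.conv (φ ∘ f) (φ ∘ g) (suc n)
        ∎

-- Determinants of Hessenberg matrices by condensation.

module Determinants {a ℓ} (R : CommutativeRing a ℓ) where
  open CommutativeRing R hiding (zero)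
  open Algebra.Definitions.RawSemiring (Semiring.rawSemiring semiring)
    using (_^_; sum)
  open Algebra.Properties.Ring ring
    using (-‿distribˡ-*; -‿+-comm; -‿involutive; -0#≈0#)
  open Algebra.Properties.Semiring.Sum semiring using (*-distribˡ-sum)
  open Algebra.Properties.CommutativeMonoid.Sum +-commutativeMonoid
    using (sum-cong-≋; ∑-distrib-+; sum-replicate-zero)
  open Algebra.Solver.Ring.NaturalCoefficients.Default commutativeSemiring
  open Relation.Binary.Reasoning.Setoid setoid
  open Matrices R
  open Convolution R

  minor : ∀ {n} → Matrix (suc n) → Fin (suc n) → Matrix n
  minor A j r s = A (suc r) (punchIn j s)

  laplaceTerm : ∀ {n} → Matrix (suc n) → Fin (suc n) → Carrier
  laplaceTerm A j = (- 1#) ^ toℕ j * A zero j * det (minor A j)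

  det-cong : ∀ {n} (A B : Matrix n) → (∀ i j → A i j ≈ B i j) → det A ≈ det B
  det-cong {zero}  A B A≈B = refl
  det-cong {suc n} A B A≈B = sum-cong-≋ {suc n} (λ j →
    *-cong (*-congˡ {(- 1#) ^ toℕ j} (A≈B zero j))
           (det-cong (minor A j) (minor B j) (λ r t → A≈B (suc r) (punchIn j t))))

  -- In the Laplace expansion, the term of column 0 varies only through its entry, since its minor
  -- omits that column. Every other term varies only through its minor, to which the induction
  -- hypothesis applies.
  det-linear-column₀ : ∀ {n} (A B C : Matrix (suc n)) x y →
    (∀ i → C i zero ≈ x * A i zero + y * B i zero) →
    (∀ i j → C i (suc j) ≈ A i (suc j)) →
    (∀ i j → C i (suc j) ≈ B i (suc j)) →
    det C ≈ x * det A + y * det B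
  det-linear-column₀ {n} A B C x y C₀≈ C≈A C≈B = begin
    det C
      ≈⟨ sum-cong-≋ linear ⟩
    sum (λ j → x * laplaceTerm A j + y * laplaceTerm B j)
      ≈⟨ ∑-distrib-+ (λ j → x * laplaceTerm A j) (λ j → y * laplaceTerm B j) ⟩
    sum (λ j → x * laplaceTerm A j) + sum (λ j → y * laplaceTerm B j)
      ≈⟨ +-cong (*-distribˡ-sum x (laplaceTerm A)) (*-distribˡ-sum y (laplaceTerm B)) ⟨
    x * det A + y * det B
      ∎
    where
    linear : ∀ j → laplaceTerm C j ≈ x * laplaceTerm A j + y * laplaceTerm B j
    linear zero = begin
      1# * C zero zero * det (minor C zero)
        ≈⟨ *-congʳ (*-congˡ (C₀≈ zero)) ⟩
      1# * (x * A zero zero + y * B zero zero) * det (minor C zero)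
        ≈⟨ solve 5 (λ x u y v d → con 1 :* (x :* u :+ y :* v) :* d
                               := x :* (con 1 :* u :* d) :+ y :* (con 1 :* v :* d))
             refl x (A zero zero) y (B zero zero) (det (minor C zero)) ⟩
      x * (1# * A zero zero * det (minor C zero)) + y * (1# * B zero zero * det (minor C zero))
        ≈⟨ +-cong (*-congˡ (*-congˡ (det-cong _ (minor A zero) (C≈A ∘ suc))))
                  (*-congˡ (*-congˡ (det-cong _ (minor B zero) (C≈B ∘ suc)))) ⟩
      x * laplaceTerm A zero + y * laplaceTerm B zero
        ∎
    -- The pattern makes the minor nonempty. Its first column is the old column 0 without its top
    -- entry, because `punchIn (suc j) zero` is `zero`.
    linear (suc {suc _} j) = begin
      s * C zero (suc j) * det (minor C (suc j))
        ≈⟨ *-congˡ (det-linear-column₀ (minor A (suc j)) (minor B (suc j)) (minor C (suc j))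
                      x y (C₀≈ ∘ suc)
                      (λ r t → C≈A (suc r) (punchIn j t)) (λ r t → C≈B (suc r) (punchIn j t))) ⟩
      s * C zero (suc j) * (x * det (minor A (suc j)) + y * det (minor B (suc j)))
        ≈⟨ solve 5 (λ u x d y e → u :* (x :* d :+ y :* e) := x :* (u :* d) :+ y :* (u :* e))
             refl (s * C zero (suc j)) x (det (minor A (suc j))) y (det (minor B (suc j))) ⟩
      x * (s * C zero (suc j) * det (minor A (suc j))) +
      y * (s * C zero (suc j) * det (minor B (suc j)))
        ≈⟨ +-cong (*-congˡ (*-congʳ (*-congˡ (C≈A zero j))))
                  (*-congˡ (*-congʳ (*-congˡ (C≈B zero j)))) ⟩
      x * laplaceTerm A (suc j) + y * laplaceTerm B (suc j)
        ∎
      where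
      s : Carrier
      s = (- 1#) ^ suc (toℕ j)

  -- Only two terms of the expansion survive, and their minors agree outside the first column, so
  -- linearity in that column merges them.
  det-condense : ∀ {n} (A : Matrix (2 ℕ.+ n)) (B : Matrix (suc n)) →
    (∀ j → A zero (suc (suc j)) ≈ 0#) →
    (∀ i → B i zero ≈ A zero zero * A (suc i) (suc zero) + (- A zero (suc zero)) * A (suc i) zero) →
    (∀ i j → B i (suc j) ≈ A (suc i) (suc (suc j))) →
    det A ≈ det B
  det-condense {n} A B A₀≈0 B₀≈ B≈A = begin
    laplaceTerm A zero + (laplaceTerm A (suc zero) + sum (λ j → laplaceTerm A (suc (suc j))))
      ≈⟨ +-cong (*-congʳ (*-identityˡ _)) (+-cong (*-congʳ second) rest) ⟩
    A zero zero * det (minor A zero) + ((- A zero (suc zero)) * det (minor A (suc zero)) + 0#)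
      ≈⟨ +-congˡ (+-identityʳ _) ⟩
    A zero zero * det (minor A zero) + (- A zero (suc zero)) * det (minor A (suc zero))
      ≈⟨ det-linear-column₀ (minor A zero) (minor A (suc zero)) B
           (A zero zero) (- A zero (suc zero)) B₀≈ B≈A B≈A ⟨
    det B
      ∎
    where
    second : (- 1#) * 1# * A zero (suc zero) ≈ - A zero (suc zero)
    second = begin
      (- 1#) * 1# * A zero (suc zero)  ≈⟨ *-congʳ (*-identityʳ (- 1#)) ⟩
      (- 1#) * A zero (suc zero)       ≈⟨ -‿distribˡ-* 1# _ ⟨
      - (1# * A zero (suc zero))       ≈⟨ -‿cong (*-identityˡ _) ⟩
      - A zero (suc zero)              ∎
    rest : sum (λ j → laplaceTerm A (suc (suc j))) ≈ 0#
    rest = trans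
      (sum-cong-≋ {n} (λ j → trans (*-congʳ (trans (*-congˡ (A₀≈0 j)) (zeroʳ _))) (zeroˡ _)))
      (sum-replicate-zero n)

  -- Rows, columns and η are indexed from 0 here, so η j stands for h (j + 1).
  hessenbergEntry : Carrier → Sequence → Sequence → ℕ → ℕ → Carrier
  hessenbergEntry z b η i j =
    z * (if i ≡ᵇ j then 1# else 0#) -
    (if j <ᵇ suc (suc i) then b (suc i ∸ j) * η j else 0#)

  -- Here `b` stands for the image of `c`, and `H n` for the product of the first `n` values of `η`.
  -- The hypothesis `g-suc` is `c * g = r` combined with `r (n + 1) = z Y n`.
  module _ {z : Carrier} {b η g Y H : Sequence}
    (b₀ : b 0 ≈ 1#)
    (g-suc : ∀ n → conv b g (suc n) ≈ z * Y n)
    (g≈ηY : ∀ n → η n * Y n ≈ g n)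
    (H-suc : ∀ n → H (suc n) ≈ H n * η n)
    where

    -- The first column left after t condensations.
    column : ℕ → ℕ → Carrier
    column t i = H (suc t) * (z * (if i ≡ᵇ 0 then 1# else 0#) * Y t -
                              conv (λ k → b (k ℕ.+ suc i)) g t)

    private
      z*0 : ∀ {x} → z * 0# - x ≈ - x
      z*0 = trans (+-congʳ (zeroʳ z)) (+-identityˡ _)

    -- By `g-suc`, `z Y t` is the full product `conv b g (suc t)`; subtracting its part with the
    -- shifted `b` leaves the single term `b 0 * g (suc t)`.
    column-head : ∀ t → column t 0 ≈ H (suc t) * g (suc t)
    column-head t = *-congˡ (begin
      z * 1# * Y t - conv (λ k → b (k ℕ.+ 1)) g t
        ≈⟨ +-cong (*-congʳ (*-identityʳ z))
             (-‿cong (conv-congˡ (λ k → reflexive (≡.cong b (ℕ.+-comm k 1))) g t)) ⟩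
      z * Y t - conv (b ∘ suc) g t
        ≈⟨ +-congʳ (g-suc t) ⟨
      conv b g (suc t) - conv (b ∘ suc) g t
        ≈⟨ +-congʳ (conv-suc b g t) ⟩
      b 0 * g (suc t) + conv (b ∘ suc) g t - conv (b ∘ suc) g t
        ≈⟨ +-assoc _ _ _ ⟩
      b 0 * g (suc t) + (conv (b ∘ suc) g t - conv (b ∘ suc) g t)
        ≈⟨ +-cong (*-congʳ b₀) (-‿inverseʳ _) ⟩
      1# * g (suc t) + 0#
        ≈⟨ solve 1 (λ x → con 1 :* x :+ con 0 := x) refl (g (suc t)) ⟩
      g (suc t)
        ∎)

    -- The pivot supplies `g (suc t) = η (suc t) * Y (suc t)`. Once `η (suc t)` is absorbed into
    -- `H`, the product `b (suc i) * g (suc t)` is exactly the missing first term of the next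
    -- convolution.
    column-suc : ∀ t i →
      column t 0 * (z * (if i ≡ᵇ 0 then 1# else 0#) - b (suc i) * η (suc t)) +
      η (suc t) * column t (suc i) ≈ column (suc t) i
    column-suc t i = begin
      column t 0 * (D - b (suc i) * η₁) + η₁ * (H (suc t) * (z * 0# * Y t - C))
        ≈⟨ +-cong (*-cong (column-head t) (+-congˡ (-‿distribˡ-* (b (suc i)) η₁)))
                  (*-congˡ (*-congˡ (trans (+-congʳ z*0*) (+-identityˡ _)))) ⟩
      H (suc t) * g (suc t) * (D + (- b (suc i)) * η₁) + η₁ * (H (suc t) * (- C))
        ≈⟨ +-congʳ (*-congʳ (*-congˡ (g≈ηY (suc t)))) ⟨
      H (suc t) * (η₁ * Y₁) * (D + (- b (suc i)) * η₁) + η₁ * (H (suc t) * (- C))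
        ≈⟨ solve 6 (λ h e y d b c → h :* (e :* y) :* (d :+ b :* e) :+ e :* (h :* c)
                                 := h :* e :* (d :* y :+ (b :* (e :* y) :+ c)))
             refl (H (suc t)) η₁ Y₁ D (- b (suc i)) (- C) ⟩
      H (suc t) * η₁ * (D * Y₁ + ((- b (suc i)) * (η₁ * Y₁) - C))
        ≈⟨ *-cong (sym (H-suc (suc t)))
                  (+-congˡ (+-congʳ (trans (*-congˡ (g≈ηY (suc t)))
                                           (sym (-‿distribˡ-* _ _))))) ⟩
      H (2 ℕ.+ t) * (D * Y₁ + (- (b (suc i) * g (suc t)) - C))
        ≈⟨ *-congˡ (+-congˡ (-‿+-comm _ _)) ⟩
      H (2 ℕ.+ t) * (D * Y₁ - (b (suc i) * g (suc t) + C))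
        ≈⟨ *-congˡ (+-congˡ (-‿cong (trans (conv-suc _ g t) (+-congˡ
             (conv-congˡ (λ k → reflexive (≡.cong b (≡.sym (ℕ.+-suc k (suc i))))) g t))))) ⟨
      column (suc t) i
        ∎
      where
      η₁ Y₁ D C : Carrier
      η₁ = η (suc t)
      Y₁ = Y (suc t)
      D  = z * (if i ≡ᵇ 0 then 1# else 0#)
      C  = conv (λ k → b (k ℕ.+ suc (suc i))) g t
      z*0* : z * 0# * Y t ≈ 0#
      z*0* = trans (*-congʳ (zeroʳ z)) (zeroˡ _)

    -- Past the first column an entry depends on its position only through `i - j` and `η`, so
    -- deleting a row and a column merely shifts `η`. With `ηₜ` as a sequence of its own, that shift
    -- holds by computation.
    det-hessenberg-from : ∀ m t (A : Matrix (suc m)) (ηₜ : Sequence) →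
      (∀ j → ηₜ j ≡ η (j ℕ.+ t)) →
      (∀ i → A i zero ≈ column t (toℕ i)) →
      (∀ i j → A i (suc j) ≈ hessenbergEntry z b ηₜ (toℕ i) (suc (toℕ j))) →
      det A ≈ H (m ℕ.+ suc t) * g (m ℕ.+ suc t)
    det-hessenberg-from zero t A ηₜ ηₜ≡ A₀≈ A≈ = begin
      1# * A zero zero * 1# + 0#  ≈⟨ solve 1 (λ x → con 1 :* x :* con 1 :+ con 0 := x) refl _ ⟩
      A zero zero                 ≈⟨ A₀≈ zero ⟩
      column t 0                  ≈⟨ column-head t ⟩
      H (suc t) * g (suc t)       ∎
    det-hessenberg-from (suc m) t A ηₜ ηₜ≡ A₀≈ A≈ = begin
      det A
        ≈⟨ det-condense A B (λ j → trans (A≈ zero (suc j)) (trans z*0 -0#≈0#))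
             (λ _ → refl) (λ _ _ → refl) ⟩
      det B
        ≈⟨ det-hessenberg-from m (suc t) B (ηₜ ∘ suc)
             (λ j → ≡.trans (ηₜ≡ (suc j)) (≡.cong η (≡.sym (ℕ.+-suc j t))))
             B₀≈ (λ i j → A≈ (suc i) (suc j)) ⟩
      H (m ℕ.+ suc (suc t)) * g (m ℕ.+ suc (suc t))
        ≡⟨ ≡.cong (λ n → H n * g n) (ℕ.+-suc m (suc t)) ⟩
      H (suc m ℕ.+ suc t) * g (suc m ℕ.+ suc t)
        ∎
      where
      B : Matrix (suc m)
      B i zero    = A zero zero * A (suc i) (suc zero) + (- A zero (suc zero)) * A (suc i) zero
      B i (suc j) = A (suc i) (suc (suc j))

      -- The minus sign of the expansion cancels the one in `zI - M`.
      superdiagonal : - A zero (suc zero) ≈ η (suc t)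
      superdiagonal = begin
        - A zero (suc zero)         ≈⟨ -‿cong (A≈ zero zero) ⟩
        - (z * 0# - b 0 * ηₜ 1)     ≈⟨ -‿cong z*0 ⟩
        - (- (b 0 * ηₜ 1))          ≈⟨ -‿involutive _ ⟩
        b 0 * ηₜ 1                  ≈⟨ *-cong b₀ (reflexive (ηₜ≡ 1)) ⟩
        1# * η (suc t)              ≈⟨ *-identityˡ _ ⟩
        η (suc t)                   ∎

      B₀≈ : ∀ i → B i zero ≈ column (suc t) (toℕ i)
      B₀≈ i = trans
        (+-cong (*-cong (A₀≈ zero)
                        (trans (A≈ (suc i) zero)
                               (+-congˡ (-‿cong (*-congˡ (reflexive (ηₜ≡ 1)))))))
                (*-cong superdiagonal (A₀≈ (suc i))))
        (column-suc t (toℕ i))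

    det-hessenberg : H 0 ≈ 1# → g 0 ≈ 1# → ∀ m (A : Matrix (suc m)) →
      (∀ i j → A i j ≈ hessenbergEntry z b η (toℕ i) (toℕ j)) →
      det A ≈ H (suc m) * g (suc m)
    det-hessenberg H₀ g₀ m A A≈ = begin
      det A
        ≈⟨ det-hessenberg-from m 0 A η (λ j → ≡.cong η (≡.sym (ℕ.+-identityʳ j)))
             (λ i → trans (A≈ i zero) (first (toℕ i))) (λ i j → A≈ i (suc j)) ⟩
      H (m ℕ.+ 1) * g (m ℕ.+ 1)
        ≡⟨ ≡.cong (λ n → H n * g n) (ℕ.+-comm m 1) ⟩
      H (suc m) * g (suc m)
        ∎
      where
      -- The untouched first column fits the general shape at `t = 0`: the convolution has one term,
      -- and the common factor `η 0 * Y 0 = g 0` is 1.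
      first : ∀ i → hessenbergEntry z b η i 0 ≈ column 0 i
      first i = sym (begin
        H 1 * (D * Y 0 - conv (λ k → b (k ℕ.+ suc i)) g 0)
          ≈⟨ *-cong H₁ (+-congˡ (-‿cong (trans (conv-zero _ g) (trans (+-identityʳ _)
               (trans (*-congˡ (sym (g≈ηY 0))) (sym (*-assoc _ _ _))))))) ⟩
        η 0 * (D * Y 0 - b (suc i) * η 0 * Y 0)
          ≈⟨ *-congˡ (+-congˡ (-‿distribˡ-* _ _)) ⟩
        η 0 * (D * Y 0 + (- (b (suc i) * η 0)) * Y 0)
          ≈⟨ solve 4 (λ e d y c → e :* (d :* y :+ c :* y) := (d :+ c) :* (e :* y))
               refl (η 0) D (Y 0) (- (b (suc i) * η 0)) ⟩
        (D - b (suc i) * η 0) * (η 0 * Y 0)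
          ≈⟨ *-congˡ (trans (g≈ηY 0) g₀) ⟩
        (D - b (suc i) * η 0) * 1#
          ≈⟨ *-identityʳ _ ⟩
        D - b (suc i) * η 0
          ∎)
        where
        D : Carrier
        D = z * (if i ≡ᵇ 0 then 1# else 0#)
        H₁ : H 1 ≈ η 0
        H₁ = trans (H-suc 0) (trans (*-congʳ H₀) (*-identityˡ _))

-- Nonnegativity of the integers `c n`.

module Coefficients where
  open import Data.Integer.Base using (_+_; _*_; _-_; -_; _^_; _≤_)
  open ≡ using (refl; sym; trans; cong; cong₂; subst)
  open Convolution ℤ.+-*-commutativeRing
    using (conv; conv≈sum; conv-zero; conv-suc; conv-congˡ; conv-*ˡ; conv-+ˡ; Inverse)

  listSum-filter-≤ : ∀ {p} {P : Pred ℕ p} (P? : Decidable P) xs →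
                     listSum (filter P? xs) ℕ.≤ listSum xs
  listSum-filter-≤ P? []       = z≤n
  listSum-filter-≤ P? (x ∷ xs) with does (P? x)
  ... | true  = ℕ.+-monoʳ-≤ x (listSum-filter-≤ P? xs)
  ... | false = ℕ.m≤n⇒m≤o+n x (listSum-filter-≤ P? xs)

  listSum-applyUpTo-≤ : ∀ f n b → (∀ i → i ℕ.< n → f i ℕ.≤ b) →
                        listSum (applyUpTo f n) ℕ.≤ n ℕ.* b
  listSum-applyUpTo-≤ f zero    b f≤b = z≤n
  listSum-applyUpTo-≤ f (suc n) b f≤b =
    ℕ.+-mono-≤ (f≤b 0 (s≤s z≤n))
      (listSum-applyUpTo-≤ (f ∘ suc) n b (λ i i<n → f≤b (suc i) (s≤s i<n)))

  -- The candidates 0, ..., k contribute at most `k` nonzero numbers, each at most `k`. This crude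
  -- bound suffices for the tail estimate.
  σ-≤ : ∀ k → σ k ℕ.≤ k ℕ.* k
  σ-≤ k = ℕ.≤-trans (listSum-filter-≤ (_∣? k) (upTo (suc k)))
                    (listSum-applyUpTo-≤ suc k k (λ _ i<k → i<k))

  s : ℕ → ℤ
  s n = -1ℤ ^ n * + σ (suc n)

  -- The exponent in the definition of `c` exceeds the one in `s (suc k)` by one, whence the factor
  -- -1.
  c-suc : ∀ n → c (suc n) ≡ -1ℤ * conv (s ∘ suc) c n
  c-suc n = begin
    c (suc n)
      ≡⟨ sum-cong-≗ {suc n} (λ i → cong (-1ℤ ^ (2 ℕ.+ toℕ i) * + σ (2 ℕ.+ toℕ i) *_)
                                        (lookup-history 1ℤ step n i)) ⟩
    sum (λ (i : Fin (suc n)) → -1ℤ ^ (2 ℕ.+ toℕ i) * + σ (2 ℕ.+ toℕ i) * c (n ∸ toℕ i))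
      ≡⟨ conv≈sum (λ k → -1ℤ * -1ℤ ^ suc k * + σ (2 ℕ.+ k)) c n ⟨
    conv (λ k → -1ℤ * -1ℤ ^ suc k * + σ (2 ℕ.+ k)) c n
      ≡⟨ conv-congˡ (λ k → ℤ.*-assoc -1ℤ (-1ℤ ^ suc k) (+ σ (2 ℕ.+ k))) c n ⟩
    conv (λ k → -1ℤ * s (suc k)) c n
      ≡⟨ conv-*ˡ -1ℤ (s ∘ suc) c n ⟩
    -1ℤ * conv (s ∘ suc) c n
      ∎
    where
    open ≡-Reasoning
    open Algebra.Definitions.RawSemiring ℤ.+-*-rawSemiring using (sum)
    step : ∀ n → Vec ℤ (suc n) → ℤ
    step n cₙ⋯c₀ = sum (λ (i : Fin (suc n)) →
      -1ℤ ^ (2 ℕ.+ toℕ i) * + σ (2 ℕ.+ toℕ i) * lookup cₙ⋯c₀ i)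
    open Algebra.Properties.Monoid.Sum ℤ.+-0-monoid using (sum-cong-≗)

  s*c≡1 : Inverse s c
  s*c≡1 zero    = conv-zero s c
  s*c≡1 (suc n) = begin
    conv s c (suc n)
      ≡⟨ conv-suc s c n ⟩
    1ℤ * c (suc n) + conv (s ∘ suc) c n
      ≡⟨ cong (λ x → 1ℤ * x + conv (s ∘ suc) c n) (c-suc n) ⟩
    1ℤ * (-1ℤ * conv (s ∘ suc) c n) + conv (s ∘ suc) c n
      ≡⟨ cancel (conv (s ∘ suc) c n) ⟩
    0ℤ
      ∎
    where
    open ≡-Reasoning
    cancel : ∀ x → 1ℤ * (-1ℤ * x) + x ≡ 0ℤ
    cancel = solve-∀

  -- A majorant for `e`: each of the four values of `s` making up `e m` is at most `(4 + m)²` in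
  -- absolute value.
  weight : ℕ → ℤ
  weight n = + 4 * (+ n * + n)

  ∣s∣-≤ : ∀ n → ∣ s n ∣ ℕ.≤ suc n ℕ.* suc n
  ∣s∣-≤ n = subst (ℕ._≤ suc n ℕ.* suc n) (sym ∣s∣≡σ) (σ-≤ (suc n))
    where
    ∣-1^∣≡1 : ∀ n → ∣ -1ℤ ^ n ∣ ≡ 1
    ∣-1^∣≡1 zero    = refl
    ∣-1^∣≡1 (suc n) = trans (ℤ.∣i*j∣≡∣i∣*∣j∣ -1ℤ (-1ℤ ^ n))
                            (trans (ℕ.*-identityˡ _) (∣-1^∣≡1 n))
    ∣s∣≡σ : ∣ s n ∣ ≡ σ (suc n)
    ∣s∣≡σ = trans (ℤ.∣i*j∣≡∣i∣*∣j∣ (-1ℤ ^ n) (+ σ (suc n)))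
                  (trans (cong (ℕ._* σ (suc n)) (∣-1^∣≡1 n)) (ℕ.*-identityˡ _))

  i≤+∣i∣ : ∀ i → i ≤ + ∣ i ∣
  i≤+∣i∣ (+ n)    = ℤ.≤-refl
  i≤+∣i∣ -[1+ n ] = -≤+

  e₀⋯e₈ : Vec ℤ 9
  e₀⋯e₈ = - + 1 ∷ - + 2 ∷ - + 3 ∷ - + 3 ∷ - + 1 ∷ + 2 ∷ + 2 ∷ - + 4 ∷ - + 11 ∷ []

  opaque
    -- e m is the coefficient of x^(m+3) in (1 + x)² (1 - x) ∑ s n x^n; the terms before
    -- it are 1 - 2 x + 0 x².
    e : ℕ → ℤ
    e m = (s (3 ℕ.+ m) + s (2 ℕ.+ m)) + -1ℤ * (s (1 ℕ.+ m) + s m)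

    -- Since (1 + x)² (1 - x) = 1 + x - x² - x³, the identities `s * c = 1` at `n + 4` and `n + 3`
    -- are added and those at `n + 2` and `n + 1` subtracted. The coefficient of `c (2 + n)` is 4 -
    -- 3 - 1 = 0, that of `c (3 + n)` is -3 + 1 = -2.
    c-recurrence : ∀ n → c (4 ℕ.+ n) ≡ + 2 * c (3 ℕ.+ n) - conv e c (suc n)
    c-recurrence n = begin
      c (4 ℕ.+ n)
        ≡⟨ combine (c (4 ℕ.+ n)) (c (3 ℕ.+ n)) (c (2 ℕ.+ n)) S₃ S₂ S₁ S₀
             zero₃ zero₂ zero₁ (s*c≡1 (1 ℕ.+ n)) ⟩
      + 2 * c (3 ℕ.+ n) - (S₃ + S₂ + -1ℤ * (S₁ + S₀))
        ≡⟨ cong (_-_ (+ 2 * c (3 ℕ.+ n))) expand ⟨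
      + 2 * c (3 ℕ.+ n) - conv e c (suc n)
        ∎
      where
      open ≡-Reasoning
      S₃ S₂ S₁ S₀ : ℤ
      S₃ = conv (λ m → s (3 ℕ.+ m)) c (suc n)
      S₂ = conv (λ m → s (2 ℕ.+ m)) c (suc n)
      S₁ = conv (λ m → s (1 ℕ.+ m)) c (suc n)
      S₀ = conv s c (suc n)

      zero₁ : 1ℤ * c (2 ℕ.+ n) + S₁ ≡ 0ℤ
      zero₁ = trans (sym (conv-suc s c (suc n))) (s*c≡1 (2 ℕ.+ n))

      zero₂ : 1ℤ * c (3 ℕ.+ n) + (-[1+ 2 ] * c (2 ℕ.+ n) + S₂) ≡ 0ℤ
      zero₂ = begin
        1ℤ * c (3 ℕ.+ n) + (-[1+ 2 ] * c (2 ℕ.+ n) + S₂)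
          ≡⟨ cong (_+_ (1ℤ * c (3 ℕ.+ n))) (conv-suc (s ∘ suc) c (1 ℕ.+ n)) ⟨
        1ℤ * c (3 ℕ.+ n) + conv (s ∘ suc) c (2 ℕ.+ n)
          ≡⟨ conv-suc s c (2 ℕ.+ n) ⟨
        conv s c (3 ℕ.+ n)
          ≡⟨ s*c≡1 (3 ℕ.+ n) ⟩
        0ℤ
          ∎

      zero₃ : 1ℤ * c (4 ℕ.+ n) + (-[1+ 2 ] * c (3 ℕ.+ n) + (+ 4 * c (2 ℕ.+ n) + S₃)) ≡ 0ℤ
      zero₃ = begin
        1ℤ * c (4 ℕ.+ n) + (-[1+ 2 ] * c (3 ℕ.+ n) + (+ 4 * c (2 ℕ.+ n) + S₃))
          ≡⟨ cong (λ t → 1ℤ * c (4 ℕ.+ n) + (-[1+ 2 ] * c (3 ℕ.+ n) + t))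
               (conv-suc (s ∘ (2 ℕ.+_)) c (1 ℕ.+ n)) ⟨
        1ℤ * c (4 ℕ.+ n) + (-[1+ 2 ] * c (3 ℕ.+ n) + conv (s ∘ (2 ℕ.+_)) c (2 ℕ.+ n))
          ≡⟨ cong (_+_ (1ℤ * c (4 ℕ.+ n))) (conv-suc (s ∘ suc) c (2 ℕ.+ n)) ⟨
        1ℤ * c (4 ℕ.+ n) + conv (s ∘ suc) c (3 ℕ.+ n)
          ≡⟨ conv-suc s c (3 ℕ.+ n) ⟨
        conv s c (4 ℕ.+ n)
          ≡⟨ s*c≡1 (4 ℕ.+ n) ⟩
        0ℤ
          ∎

      combine : ∀ c₄ c₃ c₂ t₃ t₂ t₁ t₀ →
        1ℤ * c₄ + (-[1+ 2 ] * c₃ + (+ 4 * c₂ + t₃)) ≡ 0ℤ →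
        1ℤ * c₃ + (-[1+ 2 ] * c₂ + t₂) ≡ 0ℤ → 1ℤ * c₂ + t₁ ≡ 0ℤ → t₀ ≡ 0ℤ →
        c₄ ≡ + 2 * c₃ - (t₃ + t₂ + -1ℤ * (t₁ + t₀))
      combine c₄ c₃ c₂ t₃ t₂ t₁ t₀ p₃ p₂ p₁ p₀ = begin
        c₄
          ≡⟨ identity c₄ c₃ c₂ t₃ t₂ t₁ t₀ ⟩
        rhs + (1ℤ * c₄ + (-[1+ 2 ] * c₃ + (+ 4 * c₂ + t₃)) + (1ℤ * c₃ + (-[1+ 2 ] * c₂ + t₂)) -
               (1ℤ * c₂ + t₁) - t₀)
          ≡⟨ cong (_+_ rhs) (cong₂ _-_ (cong₂ _-_ (cong₂ _+_ p₃ p₂) p₁) p₀) ⟩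
        rhs + 0ℤ
          ≡⟨ ℤ.+-identityʳ rhs ⟩
        rhs
          ∎
        where
        rhs : ℤ
        rhs = + 2 * c₃ - (t₃ + t₂ + -1ℤ * (t₁ + t₀))
        identity : ∀ c₄ c₃ c₂ t₃ t₂ t₁ t₀ → c₄ ≡
          + 2 * c₃ - (t₃ + t₂ + -1ℤ * (t₁ + t₀)) +
          (1ℤ * c₄ + (-[1+ 2 ] * c₃ + (+ 4 * c₂ + t₃)) + (1ℤ * c₃ + (-[1+ 2 ] * c₂ + t₂)) -
           (1ℤ * c₂ + t₁) - t₀)
        identity = solve-∀

      expand : conv e c (suc n) ≡ S₃ + S₂ + -1ℤ * (S₁ + S₀)
      expand = begin
        conv e c (suc n)
          ≡⟨ conv-+ˡ (λ m → s (3 ℕ.+ m) + s (2 ℕ.+ m)) (λ m → -1ℤ * (s (1 ℕ.+ m) + s m)) c (suc n) ⟩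
        conv (λ m → s (3 ℕ.+ m) + s (2 ℕ.+ m)) c (suc n) +
        conv (λ m → -1ℤ * (s (1 ℕ.+ m) + s m)) c (suc n)
          ≡⟨ cong₂ _+_ (conv-+ˡ (λ m → s (3 ℕ.+ m)) (λ m → s (2 ℕ.+ m)) c (suc n))
               (trans (conv-*ˡ -1ℤ (λ m → s (1 ℕ.+ m) + s m) c (suc n))
                      (cong (-1ℤ *_) (conv-+ˡ (λ m → s (1 ℕ.+ m)) s c (suc n)))) ⟩
        S₃ + S₂ + -1ℤ * (S₁ + S₀)
          ∎

    e-≤-weight : ∀ m → e m ≤ weight (4 ℕ.+ m)
    e-≤-weight m = ℤ.≤-trans (i≤+∣i∣ (e m)) (subst (+ ∣ e m ∣ ≤_) weight≡ (+≤+ ∣e∣≤))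
      where
      open ℕ.≤-Reasoning
      q : ℕ
      q = (4 ℕ.+ m) ℕ.* (4 ℕ.+ m)
      weight≡ : + (q ℕ.+ q ℕ.+ (q ℕ.+ q)) ≡ weight (4 ℕ.+ m)
      weight≡ = trans (cong +_ (four q)) (trans (ℤ.pos-* 4 q)
        (cong (+ 4 *_) (ℤ.pos-* (4 ℕ.+ m) (4 ℕ.+ m))))
        where
        four : ∀ x → x ℕ.+ x ℕ.+ (x ℕ.+ x) ≡ 4 ℕ.* x
        four = ℕSolver.solve-∀
      ∣s∣≤q : ∀ k → suc k ℕ.≤ 4 ℕ.+ m → ∣ s k ∣ ℕ.≤ q
      ∣s∣≤q k k< = ℕ.≤-trans (∣s∣-≤ k) (ℕ.*-mono-≤ k< k<)
      ∣e∣≤ : ∣ e m ∣ ℕ.≤ q ℕ.+ q ℕ.+ (q ℕ.+ q)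
      ∣e∣≤ = begin
        ∣ e m ∣
          ≤⟨ ℤ.∣i+j∣≤∣i∣+∣j∣ (s (3 ℕ.+ m) + s (2 ℕ.+ m)) (-1ℤ * (s (1 ℕ.+ m) + s m)) ⟩
        ∣ s (3 ℕ.+ m) + s (2 ℕ.+ m) ∣ ℕ.+ ∣ -1ℤ * (s (1 ℕ.+ m) + s m) ∣
          ≡⟨ cong (∣ s (3 ℕ.+ m) + s (2 ℕ.+ m) ∣ ℕ.+_)
               (trans (cong ∣_∣ (ℤ.-1*i≡-i (s (1 ℕ.+ m) + s m))) (ℤ.∣-i∣≡∣i∣ (s (1 ℕ.+ m) + s m))) ⟩
        ∣ s (3 ℕ.+ m) + s (2 ℕ.+ m) ∣ ℕ.+ ∣ s (1 ℕ.+ m) + s m ∣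
          ≤⟨ ℕ.+-mono-≤ (ℤ.∣i+j∣≤∣i∣+∣j∣ (s (3 ℕ.+ m)) (s (2 ℕ.+ m)))
                        (ℤ.∣i+j∣≤∣i∣+∣j∣ (s (1 ℕ.+ m)) (s m)) ⟩
        ∣ s (3 ℕ.+ m) ∣ ℕ.+ ∣ s (2 ℕ.+ m) ∣ ℕ.+ (∣ s (1 ℕ.+ m) ∣ ℕ.+ ∣ s m ∣)
          ≤⟨ ℕ.+-mono-≤ (ℕ.+-mono-≤ (∣s∣≤q (3 ℕ.+ m) ℕ.≤-refl)
                                    (∣s∣≤q (2 ℕ.+ m) (ℕ.m≤n+m (3 ℕ.+ m) 1)))
                        (ℕ.+-mono-≤ (∣s∣≤q (1 ℕ.+ m) (ℕ.m≤n+m (2 ℕ.+ m) 2))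
                                    (∣s∣≤q m (ℕ.m≤n+m (1 ℕ.+ m) 3))) ⟩
        q ℕ.+ q ℕ.+ (q ℕ.+ q)
          ∎

    e-initial : ∀ m → e (toℕ m) ≡ lookup e₀⋯e₈ m
    e-initial = toWitness {a? = all? (λ m → e (toℕ m) ℤ.≟ lookup e₀⋯e₈ m)} _

  -- Inequalities are proved by certificates: `_⊕_` and `_⊛_` build a visibly nonnegative
  -- expression, and a ring identity carries it to the goal.
  NonNeg : ℤ → Set
  NonNeg i = 0ℤ ≤ i

  infixl 6 _⊕_
  infixl 7 _⊛_

  _⊕_ : ∀ {i j} → NonNeg i → NonNeg j → NonNeg (i + j)
  _⊕_ = ℤ.+-mono-≤

  _⊛_ : ∀ {i j} → NonNeg i → NonNeg j → NonNeg (i * j)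
  _⊛_ {+ m} {+ n} _ _ = subst NonNeg (ℤ.pos-* m n) (+≤+ z≤n)

  pos : ∀ n → NonNeg (+ n)
  pos n = +≤+ z≤n

  -- ∑_{i ≥ 0} weight (j + i) / 2^i
  weightSum : ℕ → ℤ
  weightSum j = + 4 * (+ 2 * (+ j * + j) + + 4 * + j + + 6)

  -- An abstract `x` keeps all terms symbolic; only the recurrence, five values and eleven computed
  -- gaps of `c` enter.
  module Growth (x : ℕ → ℤ)
    (x-recurrence : ∀ n → x (4 ℕ.+ n) ≡ + 2 * x (3 ℕ.+ n) - conv e x (suc n))
    (x₀ : x 0 ≡ + 1) (x₁ : x 1 ≡ + 3) (x₂ : x 2 ≡ + 5) (x₃ : x 3 ≡ + 10) (x₄ : x 4 ≡ + 25)
    (initial-gaps : ∀ i → i ℕ.< 11 → NonNeg (x (5 ℕ.+ i) - + 2 * x (4 ℕ.+ i)))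
    where

    gap : ℕ → ℤ
    gap n = x (suc n) - + 2 * x n

    -- The hypothesis of a complete induction. It starts at index 4 because doubling fails early:
    -- `x 2 - 2 * x 1` is -1.
    GapsBelow : ℕ → Set
    GapsBelow k = ∀ i → i ℕ.< k → NonNeg (gap (4 ℕ.+ i))

    lower : ∀ {k} → GapsBelow (suc k) → GapsBelow k
    lower gaps i i<k = gaps i (ℕ.m≤n⇒m≤1+n i<k)

    x-nonNeg-from-4 : ∀ k → GapsBelow k → NonNeg (x (4 ℕ.+ k))
    x-nonNeg-from-4 zero    gaps = subst NonNeg (sym x₄) (pos 25)
    x-nonNeg-from-4 (suc k) gaps = subst NonNeg (regroup (x (5 ℕ.+ k)) (x (4 ℕ.+ k)))
      (gaps k ℕ.≤-refl ⊕ pos 2 ⊛ x-nonNeg-from-4 k (lower gaps))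
      where
      regroup : ∀ u v → (u - + 2 * v) + + 2 * v ≡ u
      regroup = solve-∀

    -- Doubling gives `x (n - i)` at most `x n / 2^i`, so the weights sum to `weightSum j`. The step
    -- uses `weightSum j = weight j + weightSum (j + 1) / 2`, and the gap pays for replacing half of
    -- `x (5 + k)` by `x (4 + k)`.
    conv-x-≤ : ∀ k → GapsBelow k → ∀ j f → (∀ i → f i ≤ weight (i ℕ.+ j)) →
               NonNeg (weightSum j * x (4 ℕ.+ k) - conv f x (4 ℕ.+ k))
    conv-x-≤ zero gaps j f f≤ = subst NonNeg
      (cong₂ _-_ (cong (weightSum j *_) (sym x₄)) (sym conv≡))
      (subst NonNeg (regroup (f 0) (f 1) (f 2) (f 3) (f 4) (+ j))
        (slack 0 ⊛ pos 25 ⊕ slack 1 ⊛ pos 10 ⊕ slack 2 ⊛ pos 5 ⊕ slack 3 ⊛ pos 3 ⊕ slack 4 ⊕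
         pos 4 ⊛ (pos 6 ⊛ (pos j ⊛ pos j) ⊕ pos 34 ⊛ pos j ⊕ pos 77)))
      where
      term : ∀ f {n u v} → x (suc n) ≡ u → conv (f ∘ suc) x n ≡ v → conv f x (suc n) ≡ f 0 * u + v
      term f {n} p q = trans (conv-suc f x n) (cong₂ _+_ (cong (f 0 *_) p) q)
      conv≡ : conv f x 4 ≡
        f 0 * + 25 + (f 1 * + 10 + (f 2 * + 5 + (f 3 * + 3 + (f 4 * + 1 + 0ℤ))))
      conv≡ = term f x₄ (term (f ∘ suc) x₃ (term (f ∘ (2 ℕ.+_)) x₂ (term (f ∘ (3 ℕ.+_)) x₁
        (trans (conv-zero (f ∘ (4 ℕ.+_)) x) (cong (λ y → f 4 * y + 0ℤ) x₀)))))
      slack : ∀ i → NonNeg (weight (i ℕ.+ j) - f i)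
      slack i = ℤ.i≤j⇒0≤j-i (f≤ i)
      regroup : ∀ f₀ f₁ f₂ f₃ f₄ y →
        (+ 4 * (y * y) - f₀) * + 25 +
        (+ 4 * ((+ 1 + y) * (+ 1 + y)) - f₁) * + 10 +
        (+ 4 * ((+ 2 + y) * (+ 2 + y)) - f₂) * + 5 +
        (+ 4 * ((+ 3 + y) * (+ 3 + y)) - f₃) * + 3 +
        (+ 4 * ((+ 4 + y) * (+ 4 + y)) - f₄) +
        + 4 * (+ 6 * (y * y) + + 34 * y + + 77)
        ≡ + 4 * (+ 2 * (y * y) + + 4 * y + + 6) * + 25 -
          (f₀ * + 25 + (f₁ * + 10 + (f₂ * + 5 + (f₃ * + 3 + (f₄ * + 1 + 0ℤ)))))
      regroup = solve-∀
    conv-x-≤ (suc k) gaps j f f≤ =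
      subst (λ t → NonNeg (weightSum j * x (5 ℕ.+ k) - t)) (sym (conv-suc f x (4 ℕ.+ k)))
        (subst NonNeg (regroup (f 0) (x (5 ℕ.+ k)) (x (4 ℕ.+ k)) (+ j) (conv (f ∘ suc) x (4 ℕ.+ k)))
          (ℤ.i≤j⇒0≤j-i (f≤ 0) ⊛ x-nonNeg-from-4 (suc k) gaps ⊕
           pos 4 ⊛ (pos j ⊛ pos j ⊕ pos 4 ⊛ pos j ⊕ pos 6) ⊛ gaps k ℕ.≤-refl ⊕
           conv-x-≤ k (lower gaps) (suc j) (f ∘ suc)
             (λ i → subst (λ n → f (suc i) ≤ weight n) (sym (ℕ.+-suc i j)) (f≤ (suc i)))))
      where
      regroup : ∀ f₀ c₅ c₄ y t →
        (+ 4 * (y * y) - f₀) * c₅ +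
        + 4 * (y * y + + 4 * y + + 6) * (c₅ - + 2 * c₄) +
        (+ 4 * (+ 2 * ((+ 1 + y) * (+ 1 + y)) + + 4 * (+ 1 + y) + + 6) * c₄ - t)
        ≡ + 4 * (+ 2 * (y * y) + + 4 * y + + 6) * c₅ - (f₀ * c₅ + t)
      regroup = solve-∀

    -- Rewriting the leading terms of the recurrence through x (n + 1) = 2 x n + gap n leaves
    -- positive multiples of the gaps and 1622 x k, of which weightSum 13 = 1584 pays for
    -- the tail.
    gap-expansion : ∀ k → gap (11 ℕ.+ k) ≡
      + 38 * x k + + 811 * gap k + + 400 * gap (1 ℕ.+ k) +
      + 198 * gap (2 ℕ.+ k) + + 100 * gap (3 ℕ.+ k) + + 51 * gap (4 ℕ.+ k) +
      + 25 * gap (5 ℕ.+ k) + + 11 * gap (6 ℕ.+ k) + + 4 * gap (7 ℕ.+ k) +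
      gap (8 ℕ.+ k) + (weightSum 13 * x k - conv (λ i → e (9 ℕ.+ i)) x k)
    gap-expansion k = trans (cong (_- + 2 * x (11 ℕ.+ k)) (x-recurrence (8 ℕ.+ k)))
      (regroup (x k) (x (1 ℕ.+ k)) (x (2 ℕ.+ k)) (x (3 ℕ.+ k)) (x (4 ℕ.+ k)) (x (5 ℕ.+ k))
        (x (6 ℕ.+ k)) (x (7 ℕ.+ k)) (x (8 ℕ.+ k)) (x (9 ℕ.+ k)) (x (11 ℕ.+ k))
        (r 0) (r 1) (r 2) (r 3) (r 4)
        (r 5) (r 6) (r 7) (r 8) (r 9)
        (term 0 -[1+ 0 ] (8 ℕ.+ k) (e-initial (# 0))) (term 1 -[1+ 1 ] (7 ℕ.+ k) (e-initial (# 1)))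
        (term 2 -[1+ 2 ] (6 ℕ.+ k) (e-initial (# 2))) (term 3 -[1+ 2 ] (5 ℕ.+ k) (e-initial (# 3)))
        (term 4 -[1+ 0 ] (4 ℕ.+ k) (e-initial (# 4))) (term 5 (+ 2) (3 ℕ.+ k) (e-initial (# 5)))
        (term 6 (+ 2) (2 ℕ.+ k) (e-initial (# 6))) (term 7 -[1+ 3 ] (1 ℕ.+ k) (e-initial (# 7)))
        (term 8 -[1+ 10 ] (0 ℕ.+ k) (e-initial (# 8))))
      where
      -- What remains of `conv e x (9 + k)` after its first `m` terms.
      r : ℕ → ℤ
      r m = conv (e ∘ (m ℕ.+_)) x ((9 ∸ m) ℕ.+ k)

      term : ∀ m i n → e m ≡ i →
             conv (e ∘ (m ℕ.+_)) x (suc n) ≡ i * x (suc n) + conv (e ∘ (suc m ℕ.+_)) x n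
      term m i n p = trans (conv-suc (e ∘ (m ℕ.+_)) x n)
        (cong₂ _+_ (cong (_* x (suc n)) (trans (cong e (ℕ.+-identityʳ m)) p))
                   (conv-congˡ (λ k → cong e (ℕ.+-suc m k)) x n))

      regroup : ∀ c₀ c₁ c₂ c₃ c₄ c₅ c₆ c₇ c₈ c₉ c₁₁ r₀ r₁ r₂ r₃ r₄ r₅ r₆ r₇ r₈ r₉ →
        r₀ ≡ -[1+ 0 ] * c₉ + r₁ →
        r₁ ≡ -[1+ 1 ] * c₈ + r₂ →
        r₂ ≡ -[1+ 2 ] * c₇ + r₃ →
        r₃ ≡ -[1+ 2 ] * c₆ + r₄ →
        r₄ ≡ -[1+ 0 ] * c₅ + r₅ →
        r₅ ≡ + 2 * c₄ + r₆ →
        r₆ ≡ + 2 * c₃ + r₇ →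
        r₇ ≡ -[1+ 3 ] * c₂ + r₈ →
        r₈ ≡ -[1+ 10 ] * c₁ + r₉ →
        + 2 * c₁₁ - r₀ - + 2 * c₁₁ ≡
        + 38 * c₀ + + 811 * (c₁ - + 2 * c₀) + + 400 * (c₂ - + 2 * c₁) +
        + 198 * (c₃ - + 2 * c₂) + + 100 * (c₄ - + 2 * c₃) +
        + 51 * (c₅ - + 2 * c₄) + + 25 * (c₆ - + 2 * c₅) +
        + 11 * (c₇ - + 2 * c₆) + + 4 * (c₈ - + 2 * c₇) +
        (c₉ - + 2 * c₈) + (+ 1584 * c₀ - r₉)
      regroup c₀ c₁ c₂ c₃ c₄ c₅ c₆ c₇ c₈ c₉ c₁₁ _ _ _ _ _ _ _ _ _ r₉
        refl refl refl refl refl refl refl refl refl =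
        identity c₀ c₁ c₂ c₃ c₄ c₅ c₆ c₇ c₈ c₉ c₁₁ r₉
        where
        identity : ∀ c₀ c₁ c₂ c₃ c₄ c₅ c₆ c₇ c₈ c₉ c₁₁ t →
          + 2 * c₁₁ -
            (-[1+ 0 ] * c₉ + (-[1+ 1 ] * c₈ + (-[1+ 2 ] * c₇ + (-[1+ 2 ] * c₆ +
            (-[1+ 0 ] * c₅ + (+ 2 * c₄ + (+ 2 * c₃ + (-[1+ 3 ] * c₂ +
            (-[1+ 10 ] * c₁ + t))))))))) - + 2 * c₁₁
          ≡ + 38 * c₀ + + 811 * (c₁ - + 2 * c₀) + + 400 * (c₂ - + 2 * c₁) +
            + 198 * (c₃ - + 2 * c₂) + + 100 * (c₄ - + 2 * c₃) +
            + 51 * (c₅ - + 2 * c₄) + + 25 * (c₆ - + 2 * c₅) +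
            + 11 * (c₇ - + 2 * c₆) + + 4 * (c₈ - + 2 * c₇) +
            (c₉ - + 2 * c₈) + (+ 1584 * c₀ - t)
        identity = solve-∀

    -- The expansion at `4 + k` involves `x (4 + k)` and the gaps from `4 + k` to `12 + k`, all
    -- covered by the hypothesis. Gap 15 is thus the first one within reach.
    gap-step : ∀ k → GapsBelow (9 ℕ.+ k) → NonNeg (gap (15 ℕ.+ k))
    gap-step k gaps = subst NonNeg (sym (gap-expansion (4 ℕ.+ k)))
      -- Horner's scheme at 2 on the negated `e₀⋯e₈` gives 1, 4, 11, 25, 51, 100, 198, 400, 811 and
      -- finally 1622 = 38 + 1584. The tail starts at `e 9`, bounded by `weight 13`.
      (pos 38 ⊛ x-nonNeg-from-4 k below ⊕ pos 811 ⊛ g 0 _ ⊕ pos 400 ⊛ g 1 _ ⊕ pos 198 ⊛ g 2 _ ⊕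
       pos 100 ⊛ g 3 _ ⊕ pos 51 ⊛ g 4 _ ⊕ pos 25 ⊛ g 5 _ ⊕ pos 11 ⊛ g 6 _ ⊕ pos 4 ⊛ g 7 _ ⊕ g 8 _ ⊕
       conv-x-≤ k below 13 (λ i → e (9 ℕ.+ i))
         (λ i → subst (λ n → e (9 ℕ.+ i) ≤ weight n) (ℕ.+-comm 13 i) (e-≤-weight (9 ℕ.+ i))))
      where
      below : GapsBelow k
      below i i<k = gaps i (ℕ.m≤n⇒m≤o+n 9 i<k)
      g : ∀ i → T (i ℕ.<ᵇ 9) → NonNeg (gap (i ℕ.+ (4 ℕ.+ k)))
      g i i<9 = subst (NonNeg ∘ gap) (swap i k)
        (gaps (i ℕ.+ k) (ℕ.+-monoˡ-< k (ℕ.<ᵇ⇒< i 9 i<9)))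
        where
        swap : ∀ i k → 4 ℕ.+ (i ℕ.+ k) ≡ i ℕ.+ (4 ℕ.+ k)
        swap = ℕSolver.solve-∀

    gaps-nonNeg : ∀ k → GapsBelow k
    gaps-nonNeg (suc k) i (s≤s i≤k) with ℕ.m≤n⇒m<n∨m≡n i≤k
    ... | inj₁ i<k  = gaps-nonNeg k i i<k
    ... | inj₂ refl = last i (gaps-nonNeg k)
      where
      last : ∀ i → GapsBelow i → NonNeg (gap (4 ℕ.+ i))
      last i gaps with i ℕ.<? 11
      -- These are gaps 4 to 14, which precede the range of `gap-step`.
      ... | yes i<11 = initial-gaps i i<11
      ... | no i≮11 = subst (λ j → NonNeg (gap (4 ℕ.+ j))) (ℕ.m+[n∸m]≡n 11≤i)
                        (gap-step (i ∸ 11) (λ j j< → gaps j (ℕ.≤-trans j< 9+≤)))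
        where
        11≤i = ℕ.≮⇒≥ i≮11
        9+≤ : 9 ℕ.+ (i ∸ 11) ℕ.≤ i
        9+≤ = ℕ.≤-trans (ℕ.m≤n+m _ 2) (ℕ.≤-reflexive (ℕ.m+[n∸m]≡n 11≤i))

  c-nonNeg : ∀ n → NonNeg (c n)
  c-nonNeg 0 = pos 1
  c-nonNeg 1 = pos 3
  c-nonNeg 2 = pos 5
  c-nonNeg 3 = pos 10
  c-nonNeg (suc (suc (suc (suc k)))) = x-nonNeg-from-4 k (gaps-nonNeg k)
    where
    initial-gaps : ∀ i → i ℕ.< 11 → NonNeg (c (5 ℕ.+ i) - + 2 * c (4 ℕ.+ i))
    initial-gaps i i<11 =
      subst (λ j → NonNeg (c (5 ℕ.+ j) - + 2 * c (4 ℕ.+ j))) (toℕ-fromℕ< i<11)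
        (toWitness {a? = all? (λ (j : Fin 11) → 0ℤ ℤ.≤? c (5 ℕ.+ toℕ j) - + 2 * c (4 ℕ.+ toℕ j))}
                   _ (fromℕ< i<11))
    open Growth c c-recurrence refl refl refl refl refl initial-gaps

open Coefficients using (s; s*c≡1; NonNeg; c-nonNeg)

-- The integers inside an ordered field, and the signs of the matrix entries.

module _ {k ℓ₁ ℓ₂} (K : OrderedField k ℓ₁ ℓ₂) where
  open OrderedField K using (fromℤ; _×_; product; _<_; _≤_; 0<1; +-monoˡ-<; *-positive; module <)
  open CommutativeRing (OrderedField.commutativeRing K) hiding (zero)
  open Algebra.Properties.Semiring.Mult semiring using (×-homo-+; ×1-homo-*)
  open Algebra.Properties.Ring ring
    using (-0#≈0#; -‿+-comm; -‿involutive; -‿distribˡ-*; -‿distribʳ-*)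
  open Relation.Binary.Reasoning.Setoid setoid

  -- Integer addition of mixed signs is defined through `_⊖_`; the induction cancels one unit on
  -- each side.
  fromℤ-⊖ : ∀ m n → fromℤ (m ⊖ n) ≈ m × 1# - n × 1#
  fromℤ-⊖ m       zero    = sym (trans (+-congˡ -0#≈0#) (+-identityʳ _))
  fromℤ-⊖ zero    (suc n) = sym (+-identityˡ _)
  fromℤ-⊖ (suc m) (suc n) = begin
    fromℤ (suc m ⊖ suc n)                  ≡⟨ ≡.cong fromℤ (ℤ.[1+m]⊖[1+n]≡m⊖n m n) ⟩
    fromℤ (m ⊖ n)                          ≈⟨ fromℤ-⊖ m n ⟩
    m × 1# - n × 1#                        ≈⟨ +-congˡ (+-identityˡ _) ⟨
    m × 1# + (0# - n × 1#)                 ≈⟨ +-congˡ (+-congʳ (-‿inverseʳ 1#)) ⟨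
    m × 1# + (1# - 1# - n × 1#)            ≈⟨ +-congˡ (+-assoc _ _ _) ⟩
    m × 1# + (1# + (- 1# - n × 1#))        ≈⟨ +-assoc _ _ _ ⟨
    m × 1# + 1# + (- 1# - n × 1#)          ≈⟨ +-cong (+-comm _ _) (-‿+-comm _ _) ⟩
    suc m × 1# - suc n × 1#                ∎

  fromℤ-+ : ∀ i j → fromℤ (i ℤ.+ j) ≈ fromℤ i + fromℤ j
  fromℤ-+ (+ m)    (+ n)    = ×-homo-+ 1# m n
  fromℤ-+ (+ m)    -[1+ n ] = fromℤ-⊖ m (suc n)
  fromℤ-+ -[1+ m ] (+ n)    = trans (fromℤ-⊖ n (suc m)) (+-comm _ _)
  fromℤ-+ -[1+ m ] -[1+ n ] = begin
    - (suc (suc (m ℕ.+ n)) × 1#)         ≡⟨ ≡.cong (λ l → - (l × 1#)) (ℕ.+-suc (suc m) n) ⟨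
    - ((suc m ℕ.+ suc n) × 1#)           ≈⟨ -‿cong (×-homo-+ 1# (suc m) (suc n)) ⟩
    - (suc m × 1# + suc n × 1#)          ≈⟨ -‿+-comm _ _ ⟨
    - (suc m × 1#) - suc n × 1#          ∎

  fromℤ-neg : ∀ i → fromℤ (ℤ.- i) ≈ - fromℤ i
  fromℤ-neg (+ zero)    = sym -0#≈0#
  fromℤ-neg (+ (suc n)) = refl
  fromℤ-neg -[1+ n ]    = sym (-‿involutive _)

  fromℤ-pos-* : ∀ m j → fromℤ (+ m ℤ.* j) ≈ fromℤ (+ m) * fromℤ j
  fromℤ-pos-* m (+ n) =
    trans (reflexive (≡.cong fromℤ (≡.sym (ℤ.pos-* m n)))) (×1-homo-* m n)
  fromℤ-pos-* m -[1+ n ] = begin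
    fromℤ (+ m ℤ.* -[1+ n ])         ≡⟨ ≡.cong fromℤ (ℤ.neg-distribʳ-* (+ m) (+ suc n)) ⟨
    fromℤ (ℤ.- (+ m ℤ.* + suc n))    ≈⟨ fromℤ-neg (+ m ℤ.* + suc n) ⟩
    - fromℤ (+ m ℤ.* + suc n)        ≈⟨ -‿cong (fromℤ-pos-* m (+ suc n)) ⟩
    - (fromℤ (+ m) * fromℤ (+ suc n))  ≈⟨ -‿distribʳ-* _ _ ⟩
    fromℤ (+ m) * fromℤ -[1+ n ]     ∎

  fromℤ-* : ∀ i j → fromℤ (i ℤ.* j) ≈ fromℤ i * fromℤ j
  fromℤ-* (+ m)    j = fromℤ-pos-* m j
  fromℤ-* -[1+ m ] j = begin
    fromℤ (-[1+ m ] ℤ.* j)           ≡⟨ ≡.cong fromℤ (ℤ.neg-distribˡ-* (+ suc m) j) ⟨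
    fromℤ (ℤ.- (+ suc m ℤ.* j))      ≈⟨ fromℤ-neg (+ suc m ℤ.* j) ⟩
    - fromℤ (+ suc m ℤ.* j)          ≈⟨ -‿cong (fromℤ-pos-* (suc m) j) ⟩
    - (fromℤ (+ suc m) * fromℤ j)    ≈⟨ -‿distribˡ-* _ _ ⟩
    fromℤ -[1+ m ] * fromℤ j         ∎

  fromℤ-isRingHomomorphism :
    IsRingHomomorphism (CommutativeRing.rawRing ℤ.+-*-commutativeRing) rawRing fromℤ
  fromℤ-isRingHomomorphism = record
    { isSemiringHomomorphism = record
      { isNearSemiringHomomorphism = record
        { +-isMonoidHomomorphism = record
          { isMagmaHomomorphism = record
            { isRelHomomorphism = record { cong = λ i≡j → reflexive (≡.cong fromℤ i≡j) }
            ; homo = fromℤ-+ }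
          ; ε-homo = refl }
        ; *-homo = fromℤ-* }
      ; 1#-homo = +-identityʳ 1# }
    ; -‿homo = fromℤ-neg }

  -- `product` unfolds at the first index, whereas the recursion for `∏h` adds the last factor.
  product-snoc : ∀ (f : ℕ → Carrier) n →
    product (λ (i : Fin (suc n)) → f (toℕ i)) ≈ product (λ (i : Fin n) → f (toℕ i)) * f n
  product-snoc f zero    = *-comm (f 0) 1#
  product-snoc f (suc n) = trans (*-congˡ (product-snoc (f ∘ suc) n)) (sym (*-assoc _ _ _))

  ×1-positive : ∀ n → 0# < suc n × 1#
  ×1-positive zero    = <.<-respʳ-≈ (sym (+-identityʳ 1#)) 0<1
  ×1-positive (suc n) = <.trans (×1-positive n)
    (<.<-respˡ-≈ (+-identityˡ _) (+-monoˡ-< (suc n × 1#) 0<1))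

  -- As `≤` is a negated `<`, a zero integer is settled by irreflexivity and a positive one by
  -- asymmetry.
  fromℤ-*-nonNeg : ∀ {i x} → NonNeg i → 0# < x → 0# ≤ fromℤ i * x
  fromℤ-*-nonNeg {+ zero}    _ 0<x ix<0 = <.irrefl (zeroˡ _) ix<0
  fromℤ-*-nonNeg {+ (suc n)} _ 0<x ix<0 = <.asym ix<0 (*-positive (×1-positive n) 0<x)

  module _ (h : ℕ → Carrier) where
    open DArcais K h

    entry-nonNeg : Positive → ∀ i j → 0# ≤ entry (suc i) (suc j)
    entry-nonNeg h>0 i j with does (suc j ℕ.≤? suc (suc i))
    ... | true  = fromℤ-*-nonNeg (c-nonNeg (suc (suc i) ∸ suc j)) (h>0 j)
    ... | false = <.irrefl refl

-- Links `identity`, indexed by `Fin`, with the test on naturals in `hessenbergEntry`.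
does-≟ : ∀ {n} (i j : Fin n) → does (i ≟ j) ≡ (toℕ i ≡ᵇ toℕ j)
does-≟ zero    zero    = ≡.refl
does-≟ zero    (suc j) = ≡.refl
does-≟ (suc i) zero    = ≡.refl
does-≟ (suc i) (suc j) = does-≟ i j

-- The polynomials `P` and the characteristic determinant.

module DeterminantFormula {k ℓ₁ ℓ₂ a ℓ} (K : OrderedField k ℓ₁ ℓ₂)
  (h : ℕ → OrderedField.Carrier K) (h>0 : DArcais.Positive K h)
  (A : CommutativeAlgebra K a ℓ) (z : CommutativeAlgebra.Carrier A) where
  private module K = OrderedField K
  open CommutativeAlgebra A hiding (zero)
  open IsRingHomomorphism isRingHomomorphism
  open DArcais K h
  open Matrices commutativeRing
  open Convolution commutativeRing
  open Determinants commutativeRing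
  open Algebra.Properties.Ring ring
    using (-‿involutive; -‿distribˡ-*; -‿distribʳ-*; -1*x≈-x)
  open Algebra.Properties.Semiring.Mult semiring using (×-assoc-*; ×-congʳ)
  open Algebra.Properties.CommutativeMonoid.Sum +-commutativeMonoid using (sum-cong-≋)
  open Algebra.Solver.Ring.NaturalCoefficients.Default commutativeSemiring
  open Relation.Binary.Reasoning.Setoid setoid

  φ : ℤ → Carrier
  φ i = ι (K.fromℤ i)

  φ-isRingHomomorphism :
    IsRingHomomorphism (CommutativeRing.rawRing ℤ.+-*-commutativeRing) rawRing φ
  φ-isRingHomomorphism =
    Composition.isRingHomomorphism trans (fromℤ-isRingHomomorphism K) isRingHomomorphism

  module φ = IsRingHomomorphism φ-isRingHomomorphism

  φ-+ : ∀ n → φ (+ n) ≈ n × 1#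
  φ-+ zero    = φ.0#-homo
  φ-+ (suc n) = trans (φ.+-homo 1ℤ (+ n)) (+-cong φ.1#-homo (φ-+ n))

  φ-sign : ∀ n → φ (-1ℤ ℤ.^ n) ≈ (- 1#) ^ n
  φ-sign zero    = φ.1#-homo
  φ-sign (suc n) = trans (φ.*-homo -1ℤ (-1ℤ ℤ.^ n))
    (*-cong (trans (φ.-‿homo 1ℤ) (-‿cong φ.1#-homo)) (φ-sign n))

  sign² : ∀ n → (- 1#) ^ n * (- 1#) ^ n ≈ 1#
  sign² zero    = *-identityˡ 1#
  sign² (suc n) = begin
    (- 1#) * (- 1#) ^ n * ((- 1#) * (- 1#) ^ n)
      ≈⟨ solve 2 (λ m x → m :* x :* (m :* x) := m :* m :* (x :* x)) refl (- 1#) ((- 1#) ^ n) ⟩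
    (- 1#) * (- 1#) * ((- 1#) ^ n * (- 1#) ^ n)
      ≈⟨ *-cong (trans (-1*x≈-x (- 1#)) (-‿involutive 1#)) (sign² n) ⟩
    1# * 1#
      ≈⟨ *-identityˡ 1# ⟩
    1#
      ∎

  φ-s : ∀ n → (- 1#) ^ n * (σ (suc n) × 1#) ≈ φ (s n)
  φ-s n = sym (trans (φ.*-homo (-1ℤ ℤ.^ n) (+ σ (suc n)))
                             (*-cong (φ-sign n) (φ-+ (σ (suc n)))))

  c*s≈1 : Inverse (φ ∘ c) (φ ∘ s)
  c*s≈1 n = begin
    conv (φ ∘ c) (φ ∘ s) n
      ≈⟨ conv-comm (φ ∘ c) (φ ∘ s) n ⟩
    conv (φ ∘ s) (φ ∘ c) n
      ≈⟨ conv-map ℤ.+-*-commutativeRing commutativeRing φ-isRingHomomorphism s c n ⟨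
    φ (Convolution.conv ℤ.+-*-commutativeRing s c n)
      ≡⟨ ≡.cong φ (s*c≡1 n) ⟩
    φ (if n ≡ᵇ 0 then 1ℤ else 0ℤ)
      ≈⟨ φ-if n ⟩
    (if n ≡ᵇ 0 then 1# else 0#)
      ∎
    where
    φ-if : ∀ n → φ (if n ≡ᵇ 0 then 1ℤ else 0ℤ) ≈ (if n ≡ᵇ 0 then 1# else 0#)
    φ-if zero    = φ.1#-homo
    φ-if (suc n) = φ.0#-homo

  -- `Y n` plays the part of `r (suc n) / z` but is built without dividing by `z`, which may fail to
  -- be invertible. `ρ n` is the inverse of `η n`.
  p r η ρ S Y g H : Sequence
  p n = P A h>0 n (- z)
  r n = (- 1#) ^ n * p n
  η n = ι (h (suc n))
  ρ n = ι (K.recip (h>0 n))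
  S n = conv (λ k → σ (suc k) × 1#) p n
  Y n = (- 1#) ^ n * (ρ n * S n)
  g   = conv (φ ∘ s) r
  H n = ι (∏h n)

  p-suc : ∀ n → p (suc n) ≈ (- z) * ρ n * S n
  p-suc n = *-congˡ (begin
    sum (λ (i : Fin (suc n)) → σ (suc (toℕ i)) × lookup (history 1# step n) i)
      ≈⟨ sum-cong-≋ {suc n} (λ i → trans
           (×-congʳ (σ (suc (toℕ i))) (trans (reflexive (lookup-history 1# step n i))
                                             (sym (*-identityˡ _))))
           (sym (×-assoc-* (σ (suc (toℕ i))) 1# (p (n ∸ toℕ i))))) ⟩
    sum (λ (i : Fin (suc n)) → (σ (suc (toℕ i)) × 1#) * p (n ∸ toℕ i))
      ≈⟨ conv≈sum (λ k → σ (suc k) × 1#) p n ⟨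
    S n
      ∎)
    where
    step : ∀ m → Vec Carrier (suc m) → Carrier
    step m pₘ⋯p₀ = (- z) * ι (K.recip (h>0 m)) *
      sum (λ (i : Fin (suc m)) → σ (suc (toℕ i)) × lookup pₘ⋯p₀ i)

  r-suc : ∀ n → r (suc n) ≈ z * Y n
  r-suc n = begin
    (- 1#) * (- 1#) ^ n * p (suc n)
      ≈⟨ *-congˡ (p-suc n) ⟩
    (- 1#) * (- 1#) ^ n * ((- z) * ρ n * S n)
      ≈⟨ solve 5 (λ m e w x y → m :* e :* (w :* x :* y) := (m :* w) :* (e :* (x :* y)))
           refl (- 1#) ((- 1#) ^ n) (- z) (ρ n) (S n) ⟩
    (- 1#) * (- z) * Y n
      ≈⟨ *-congʳ (trans (-1*x≈-x (- z)) (-‿involutive z)) ⟩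
    z * Y n
      ∎

  -- `ρ n` cancels `η n`, and the sign spreads over both factors of `S n`, turning the divisor sums
  -- into `s` and `p` into `r`.
  g≈ηY : ∀ n → η n * Y n ≈ g n
  g≈ηY n = begin
    η n * ((- 1#) ^ n * (ρ n * S n))
      ≈⟨ solve 4 (λ x e y w → x :* (e :* (y :* w)) := y :* x :* (e :* w))
           refl (η n) ((- 1#) ^ n) (ρ n) (S n) ⟩
    ρ n * η n * ((- 1#) ^ n * S n)
      ≈⟨ *-congʳ (ι-inverse (K.recip-inverseˡ (h>0 n))) ⟩
    1# * ((- 1#) ^ n * S n)
      ≈⟨ *-identityˡ _ ⟩
    (- 1#) ^ n * S n
      ≈⟨ ^-conv (- 1#) (λ k → σ (suc k) × 1#) p n ⟩
    conv (λ k → (- 1#) ^ k * (σ (suc k) × 1#)) r n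
      ≈⟨ conv-congˡ φ-s r n ⟩
    g n
      ∎
    where
    ι-inverse : ∀ {x y} → x K.* y K.≈ K.1# → ι x * ι y ≈ 1#
    ι-inverse xy≈1 = trans (sym (*-homo _ _)) (trans (⟦⟧-cong xy≈1) 1#-homo)

  -- Associativity and `c * s = 1` turn `c * (s * r)` into `r`.
  c*g-suc : ∀ n → conv (φ ∘ c) g (suc n) ≈ z * Y n
  c*g-suc n = trans (conv-cancel c*s≈1 r (suc n)) (r-suc n)

  H-suc : ∀ n → H (suc n) ≈ H n * η n
  H-suc n = trans (⟦⟧-cong (product-snoc K (h ∘ suc) n)) (*-homo _ _)

  g₀≈1 : g 0 ≈ 1#
  g₀≈1 = begin
    g 0                           ≈⟨ conv-zero (φ ∘ s) r ⟩
    φ 1ℤ * (1# * 1#) + 0#         ≈⟨ +-congʳ (*-congʳ φ.1#-homo) ⟩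
    1# * (1# * 1#) + 0#           ≈⟨ solve 0 (con 1 :* (con 1 :* con 1) :+ con 0 := con 1) refl ⟩
    1#                            ∎

  -- The shifts from 1-based to 0-based indices, in the comparison and in the subtraction, hold by
  -- computation.
  zI-M≈hessenberg : ∀ m (i j : Fin (suc m)) →
    zI-M A (2 ℕ.+ m) z i j ≈ hessenbergEntry z (φ ∘ c) η (toℕ i) (toℕ j)
  zI-M≈hessenberg m i j = +-cong
    (*-congˡ (reflexive (≡.cong (if_then 1# else 0#) (does-≟ i j))))
    (-‿cong (ι-if (toℕ j <ᵇ suc (suc (toℕ i)))))
    where
    ι-if : ∀ b {x y} → ι (if b then x K.* y else K.0#) ≈ (if b then ι x * ι y else 0#)
    ι-if true  = *-homo _ _
    ι-if false = 0#-homo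

  det-zI-M : ∀ m → det (zI-M A (2 ℕ.+ m) z) ≈ H (2 ℕ.+ m) * Y (suc m)
  det-zI-M m = begin
    det (zI-M A (2 ℕ.+ m) z)
      ≈⟨ det-hessenberg φ.1#-homo c*g-suc g≈ηY H-suc 1#-homo g₀≈1 m _ (zI-M≈hessenberg m) ⟩
    H (suc m) * g (suc m)
      ≈⟨ *-congˡ (g≈ηY (suc m)) ⟨
    H (suc m) * (η (suc m) * Y (suc m))
      ≈⟨ *-assoc _ _ _ ⟨
    H (suc m) * η (suc m) * Y (suc m)
      ≈⟨ *-congʳ (H-suc (suc m)) ⟨
    H (2 ℕ.+ m) * Y (suc m)
      ∎

  P-formula : ∀ m → let n = 2 ℕ.+ m in
    P A h>0 n (- z) ≈ (- 1#) ^ n * z * ι (K.recip (∏h-positive h>0 n)) * det (zI-M A n z)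
  P-formula m = begin
    p n
      ≈⟨ *-identityˡ (p n) ⟨
    1# * p n
      ≈⟨ *-congʳ (sign² n) ⟨
    (- 1#) ^ n * (- 1#) ^ n * p n
      ≈⟨ *-assoc _ _ _ ⟩
    (- 1#) ^ n * r n
      ≈⟨ *-congˡ (r-suc (suc m)) ⟩
    (- 1#) ^ n * (z * Y (suc m))
      ≈⟨ *-congˡ (*-congˡ (*-identityˡ _)) ⟨
    (- 1#) ^ n * (z * (1# * Y (suc m)))
      -- A factor 1 is written as `∏h n` times its inverse, so that `∏h n` joins `Y (suc m)` to form
      -- the determinant.
      ≈⟨ *-congˡ (*-congˡ (*-congʳ (trans (⟦⟧-cong (K.recip-inverseˡ ∏h>0)) 1#-homo))) ⟨
    (- 1#) ^ n * (z * (ι (K.recip ∏h>0 K.* ∏h n) * Y (suc m)))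
      ≈⟨ *-congˡ (*-congˡ (*-congʳ (*-homo _ _))) ⟩
    (- 1#) ^ n * (z * (ι (K.recip ∏h>0) * H n * Y (suc m)))
      ≈⟨ solve 5 (λ e z x h y → e :* (z :* (x :* h :* y)) := e :* z :* x :* (h :* y))
           refl ((- 1#) ^ n) z (ι (K.recip ∏h>0)) (H n) (Y (suc m)) ⟩
    (- 1#) ^ n * z * ι (K.recip ∏h>0) * (H n * Y (suc m))
      ≈⟨ *-congˡ (det-zI-M m) ⟨
    (- 1#) ^ n * z * ι (K.recip ∏h>0) * det (zI-M A n z)
      ∎
    where
    n : ℕ
    n = 2 ℕ.+ m
    ∏h>0 : K.0# K.< ∏h n
    ∏h>0 = ∏h-positive h>0 n

open import Data.Product.Base using (_×_; _,_)

theorem2p3 :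
    ∀ {k ℓ₁ ℓ₂ a ℓ} (K : OrderedField k ℓ₁ ℓ₂) →
    let module K = OrderedField K in
    (h : ℕ → K.Carrier) →
    let open DArcais K h in
    (h>0 : Positive) → h 1 K.≈ K.1# →
    ∀ n → 2 ℕ.≤ n →
    ((A : CommutativeAlgebra K a ℓ) →
     let open CommutativeAlgebra A
         open Matrices commutativeRing in
     ∀ z → P A h>0 n (- z) ≈
           (- 1#) ^ n * z * ι (K.recip (∏h-positive h>0 n)) * det (zI-M A n z))
    × (∀ i j → K.0# K.≤ M n i j)
theorem2p3 K h h>0 _ (suc (suc m)) (s≤s (s≤s _)) =
  (λ A z → DeterminantFormula.P-formula K h h>0 A z m) ,
  (λ i j → entry-nonNeg K h h>0 (toℕ i) (toℕ j))
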